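{- Let $\mathcal{G}_1$ be an $r_1$-regular graph on $n_1$ vertices and $\mathcal{G}_2$ an $r_2$-regular graph on $n_2$ vertices. Let $\nu_{11},\nu_{12},\ldots,\nu_{1n_1}$ be the signless Laplacian eigenvalues of $\mathcal{G}_1$. Then the signless Laplacian characteristic polynomial of $\mathcal{G}_1\circledast\mathcal{G}_2$ satisfies $$f(Q_{\mathcal{G}_1\circledast \mathcal{G}_2},x)=(x-r_1n_2-n_2)^{n_1(n_2-1)}\, f(Q_{\mathcal{G}_2},x-n_2)^{n_1}\cdot \prod_{i=1}^{n_1}\big[x-n_2-n_2\nu_{1i}-n_2\chi_{Q_{\mathcal{G}_2}}(x-n_2)\big].$$
   Context: All graphs are simple, finite and undirected. For a graph $\mathcal{G}$ with adjacency matrix $A_{\mathcal{G}}$ and diagonal degree matrix $D_{\mathcal{G}}$, the signless Laplacian matrix is $Q_{\mathcal{G}}=D_{\mathcal{G}}+A_{\mathcal{G}}$. For a square matrix $M$, $f(M,x)=\det(xI-M)$. The signless Laplacian coronal of a graph $\mathcal{G}$ on $n$ vertices is the rational function $\chi_{Q_{\mathcal{G}}}(x)=\mathbf{1}_n^T(xI_n-Q_{\mathcal{G}})^{ -1}\mathbf{1}_n$, with $\mathbf{1}_n$ the all-ones column vector. The graph product $\mathcal{G}_1\circledast\mathcal{G}_2$ of $\mathcal{G}_1$ (vertices $u_1,\ldots,u_{n_1}$) and $\mathcal{G}_2$ (vertices $v_1,\ldots,v_{n_2}$) has vertex set $\{a_{ik},b_{ik}:1\le i\le n_1,1\le k\le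 n_2\}$ and edges: (1) $a_{ik}a_{jl}$ for all $1\le k,l\le n_2$ whenever $u_iu_j\in E(\mathcal{G}_1)$; (2) $b_{ri}b_{rj}$ for all $1\le r\le n_1$ whenever $v_iv_j\in E(\mathcal{G}_2)$; (3) $a_{ip}b_{iq}$ for all $1\le i\le n_1$, $1\le p,q\le n_2$. The identity is one of rational functions in $x$. -}

module Defs where

open import Level using (Level; _⊔_)
open import Algebra.Bundles using (CommutativeRing; CommutativeMonoid)
open import Algebra.Apartness.Bundles using (HeytingField; HeytingCommutativeRing)
import Algebra.Apartness.Properties.HeytingCommutativeRing as HeytingProperties
import Algebra.Properties.CommutativeMonoid.Sum as CommutativeMonoidSum
import Algebra.Properties.CommutativeSemigroup as CommutativeSemigroupProperties
import Algebra.Properties.Ring as RingProperties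
import Algebra.Properties.Semiring.Exp as Exponentiation
import Algebra.Properties.Semiring.Mult as Multiples
import Algebra.Properties.Semiring.Sum as SemiringSum
import Algebra.Solver.Ring.NaturalCoefficients.Default as SemiringSolver
open import Data.Bool.Base using (Bool; true; false; if_then_else_; _∧_)
open import Data.Bool.Properties using (∧-zeroʳ)
open import Data.Fin.Base using (Fin; zero; suc; toℕ; punchIn; splitAt; remQuot)
open import Data.Fin.Properties using (_≟_)
open import Data.Fin.Subset using (Subset; ∣_∣)
open import Data.List.Base using (List; []; _∷_; map)
open import Data.Nat.Base as ℕ using (ℕ; zero; suc; NonZero; s≤s; z≤n)
import Data.Nat.Properties as ℕₚ
open import Data.Product.Base using (∃; Σ-syntax; _×_; _,_; proj₁; proj₂)
open import Data.Sum.Base as Sum using (_⊎_; inj₁; inj₂)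
open import Data.Vec.Base using (tabulate)
open import Function.Base using (_∘_; flip; id)
open import Relation.Binary.PropositionalEquality as ≡ using (_≡_)
import Relation.Binary.Reasoning.Setoid as SetoidReasoning
open import Relation.Nullary.Decidable.Core using (does)
open import Relation.Nullary.Negation using (contradiction)

private
  variable
    c ℓ ℓ₁ ℓ₂ s : Level
    k m n : ℕ

------------------------------------------------------------------------
-- Graphs

record Graph (n : ℕ) : Set where
  field
    adjacent  : Fin n → Fin n → Bool
    symmetric : ∀ i j → adjacent i j ≡ adjacent j i
    loopless  : ∀ i → adjacent i i ≡ false

open Graph public

neighbours : Graph n → Fin n → Subset n
neighbours G i = tabulate (adjacent G i)

degree : Graph n → Fin n → ℕ
degree G i = ∣ neighbours G i ∣

Regular : ℕ → Graph n → Set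
Regular r G = ∀ i → degree G i ≡ r

private
  ≟-comm : (i j : Fin n) → does (i ≟ j) ≡ does (j ≟ i)
  ≟-comm zero    zero    = ≡.refl
  ≟-comm zero    (suc j) = ≡.refl
  ≟-comm (suc i) zero    = ≡.refl
  ≟-comm (suc i) (suc j) = ≟-comm i j

-- The product's vertices as a sum: inj₁ (i , k) is aᵢₖ and
-- inj₂ (i , k) is bᵢₖ.

module _ {n₁ n₂ : ℕ} where

  ProductVertex : Set
  ProductVertex = (Fin n₁ × Fin n₂) ⊎ (Fin n₁ × Fin n₂)

  productVertex : Fin (n₁ ℕ.* n₂ ℕ.+ n₁ ℕ.* n₂) → ProductVertex
  productVertex v = Sum.map (remQuot n₂) (remQuot n₂) (splitAt (n₁ ℕ.* n₂) v)

  module _ (G₁ : Graph n₁) (G₂ : Graph n₂) where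

    productAdjacent : ProductVertex → ProductVertex → Bool
    productAdjacent (inj₁ (i , k)) (inj₁ (j , l)) = adjacent G₁ i j
    productAdjacent (inj₂ (r , i)) (inj₂ (s , j)) = does (r ≟ s) ∧ adjacent G₂ i j
    productAdjacent (inj₁ (i , p)) (inj₂ (j , q)) = does (i ≟ j)
    productAdjacent (inj₂ (i , p)) (inj₁ (j , q)) = does (i ≟ j)

    private
      productAdjacent-sym : ∀ u v → productAdjacent u v ≡ productAdjacent v u
      productAdjacent-sym (inj₁ (i , _)) (inj₁ (j , _)) = symmetric G₁ i j
      productAdjacent-sym (inj₂ (r , i)) (inj₂ (s , j)) =
        ≡.cong₂ _∧_ (≟-comm r s) (symmetric G₂ i j)
      productAdjacent-sym (inj₁ (i , _)) (inj₂ (j , _)) = ≟-comm i j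
      productAdjacent-sym (inj₂ (i , _)) (inj₁ (j , _)) = ≟-comm i j

      productAdjacent-irrefl : ∀ v → productAdjacent v v ≡ false
      productAdjacent-irrefl (inj₁ (i , _)) = loopless G₁ i
      productAdjacent-irrefl (inj₂ (r , i)) =
        ≡.trans (≡.cong (does (r ≟ r) ∧_) (loopless G₂ i)) (∧-zeroʳ _)

    infixl 7 _⊛_

    _⊛_ : Graph (n₁ ℕ.* n₂ ℕ.+ n₁ ℕ.* n₂)
    _⊛_ = record
      { adjacent  = λ u v → productAdjacent (productVertex u) (productVertex v)
      ; symmetric = λ u v → productAdjacent-sym (productVertex u) (productVertex v)
      ; loopless  = λ v → productAdjacent-irrefl (productVertex v)
      }

------------------------------------------------------------------------
-- Matrices over a commutative ring

module Matrices (R : CommutativeRing c ℓ) where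

  open CommutativeRing R hiding (zero)
  open SemiringSum semiring
  open Exponentiation semiring using (_^_)
  open Multiples semiring using () renaming (_×_ to _×′_)

  infixl 7 _*ᴹ_
  infix  4 _≈ᴹ_

  Matrix : ℕ → ℕ → Set c
  Matrix m n = Fin m → Fin n → Carrier

  _≈ᴹ_ : Matrix m n → Matrix m n → Set ℓ
  A ≈ᴹ B = ∀ i j → A i j ≈ B i j

  diagonal : (Fin n → Carrier) → Matrix n n
  diagonal d i j = if does (i ≟ j) then d i else 0#

  Iᴹ : Matrix n n
  Iᴹ = diagonal (λ _ → 1#)

  _*ᴹ_ : Matrix k m → Matrix m n → Matrix k n
  (A *ᴹ B) i j = sum (λ l → A i l * B l j)

  transpose : Matrix m n → Matrix n m
  transpose A i j = A j i

  -- Laplace expansion along the first row.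
  det : Matrix n n → Carrier
  det {zero}  A = 1#
  det {suc n} A =
    sum (λ j → (- 1#) ^ toℕ j * A zero j * det (λ i k → A (suc i) (punchIn j k)))

  record Inverse (A : Matrix n n) : Set (c ⊔ ℓ) where
    field
      matrix   : Matrix n n
      inverseˡ : matrix *ᴹ A ≈ᴹ Iᴹ
      inverseʳ : A *ᴹ matrix ≈ᴹ Iᴹ

  fromℕ : ℕ → Carrier
  fromℕ n = n ×′ 1#

  degreeMatrix adjacencyMatrix signlessLaplacian : Graph n → Matrix n n
  degreeMatrix      G     = diagonal (λ i → fromℕ (degree G i))
  adjacencyMatrix   G i j = if adjacent G i j then 1# else 0#
  signlessLaplacian G i j = degreeMatrix G i j + adjacencyMatrix G i j

  open SetoidReasoning setoid
  open RingProperties ring using (-‿distribˡ-*; -‿distribʳ-*; -‿+-comm)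
  private module S = SemiringSolver commutativeSemiring

  *ᴹ-congˡ : (A : Matrix k m) {B B′ : Matrix m n} → B ≈ᴹ B′ → A *ᴹ B ≈ᴹ A *ᴹ B′
  *ᴹ-congˡ A B≈ i j = sum-cong-≋ (λ l → *-congˡ (B≈ l j))

  *ᴹ-congʳ : {A A′ : Matrix k m} (B : Matrix m n) → A ≈ᴹ A′ → A *ᴹ B ≈ᴹ A′ *ᴹ B
  *ᴹ-congʳ B A≈ i j = sum-cong-≋ (λ l → *-congʳ (A≈ i l))

  *ᴹ-assoc : ∀ {h} (A : Matrix h k) (B : Matrix k m) (C : Matrix m n) →
             (A *ᴹ B) *ᴹ C ≈ᴹ A *ᴹ (B *ᴹ C)
  *ᴹ-assoc A B C i j = begin
    sum (λ l → sum (λ h → A i h * B h l) * C l j)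
      ≈⟨ sum-cong-≋ (λ l → *-distribʳ-sum (C l j) (λ h → A i h * B h l)) ⟩
    sum (λ l → sum (λ h → A i h * B h l * C l j))
      ≈⟨ ∑-comm (λ l h → A i h * B h l * C l j) ⟩
    sum (λ h → sum (λ l → A i h * B h l * C l j))
      ≈⟨ sum-cong-≋ (λ h → sum-cong-≋ (λ l → *-assoc (A i h) (B h l) (C l j))) ⟩
    sum (λ h → sum (λ l → A i h * (B h l * C l j)))
      ≈⟨ sum-cong-≋ (λ h → *-distribˡ-sum (A i h) (λ l → B h l * C l j)) ⟨
    sum (λ h → A i h * sum (λ l → B h l * C l j)) ∎

  sum-zero : (f : Fin n → Carrier) → (∀ i → f i ≈ 0#) → sum f ≈ 0#
  sum-zero {n} f f≈0 = trans (sum-cong-≋ f≈0) (sum-replicate-zero n)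

  *ᴹ-identityˡ : (A : Matrix m n) → Iᴹ *ᴹ A ≈ᴹ A
  *ᴹ-identityˡ A zero j = begin
    1# * A zero j + sum (λ l → 0# * A (suc l) j)
      ≈⟨ +-cong (*-identityˡ _) (sum-zero (λ l → 0# * A (suc l) j) (λ l → zeroˡ (A (suc l) j))) ⟩
    A zero j + 0#  ≈⟨ +-identityʳ _ ⟩
    A zero j       ∎
  *ᴹ-identityˡ A (suc i) j = begin
    0# * A zero j + sum (λ l → Iᴹ i l * A (suc l) j)
      ≈⟨ +-cong (zeroˡ _) (*ᴹ-identityˡ (λ i → A (suc i)) i j) ⟩
    0# + A (suc i) j  ≈⟨ +-identityˡ _ ⟩
    A (suc i) j       ∎

  Iᴹ-symmetric : (i j : Fin n) → Iᴹ i j ≈ Iᴹ j i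
  Iᴹ-symmetric i j =
    reflexive (≡.cong (λ b → if b then 1# else 0#) (≟-comm i j))

  transpose-*ᴹ : (A : Matrix k m) (B : Matrix m n) →
                 transpose (A *ᴹ B) ≈ᴹ transpose B *ᴹ transpose A
  transpose-*ᴹ A B i j = sum-cong-≋ (λ l → *-comm (A j l) (B l i))

  *ᴹ-identityʳ : (A : Matrix m n) → A *ᴹ Iᴹ ≈ᴹ A
  *ᴹ-identityʳ A i j = begin
    (A *ᴹ Iᴹ) i j            ≈⟨ transpose-*ᴹ A Iᴹ j i ⟩
    (transpose Iᴹ *ᴹ transpose A) j i
      ≈⟨ *ᴹ-congʳ (transpose A) (λ i j → Iᴹ-symmetric j i) j i ⟩
    (Iᴹ *ᴹ transpose A) j i  ≈⟨ *ᴹ-identityˡ (transpose A) j i ⟩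
    A i j                    ∎

  cancel : ∀ a b → - a + (a + b) ≈ b
  cancel a b = begin
    - a + (a + b)  ≈⟨ +-assoc _ _ _ ⟨
    - a + a + b    ≈⟨ +-congʳ (-‿inverseˡ a) ⟩
    0# + b         ≈⟨ +-identityˡ b ⟩
    b              ∎

  infix 8 _·I-_

  _·I-_ : Carrier → Matrix n n → Matrix n n
  (t ·I- P) i j = t * Iᴹ i j - P i j

  -- t·I - P is invertible whenever the entries of P lie in a subset O,
  -- closed under + and *, such that t - p has an inverse in O for every
  -- p in O (by induction on the dimension, through Schur complements).
  module _
    (O : Carrier → Set s)
    (O-+ : ∀ {a b} → O a → O b → O (a + b))
    (O-* : ∀ {a b} → O a → O b → O (a * b))
    (t : Carrier)
    (invert : ∀ {p} → O p → Σ[ e ∈ Carrier ] O e × e * (t - p) ≈ 1#)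
    where

    private
      leftInverse : ∀ {n} (P : Matrix n n) → (∀ i j → O (P i j)) →
                    Σ[ N ∈ Matrix n n ] N *ᴹ (t ·I- P) ≈ᴹ Iᴹ
      leftInverse {zero}  P P∈O = (λ ()) , λ ()
      leftInverse {suc n} P P∈O = N , proof
        where
        p = P zero zero
        e = proj₁ (invert (P∈O zero zero))
        e∈O = proj₁ (proj₂ (invert (P∈O zero zero)))
        e[t-p]≈1 = proj₂ (proj₂ (invert (P∈O zero zero)))

        row : Fin n → Carrier
        row j = P zero (suc j)

        col : Fin n → Carrier
        col i = P (suc i) zero

        D : Matrix n n
        D i j = P (suc i) (suc j)

        D+cer : Matrix n n
        D+cer i j = D i j + col i * (e * row j)

        ih = leftInverse D+cer λ i j →
          O-+ (P∈O (suc i) (suc j)) (O-* (P∈O (suc i) zero) (O-* e∈O (P∈O zero (suc j))))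

        T : Matrix n n
        T = proj₁ ih

        TS≈I : T *ᴹ (t ·I- D+cer) ≈ᴹ Iᴹ
        TS≈I = proj₂ ih

        -- One-row and one-column views, so that matrix laws apply.
        R₁ : Matrix 1 n
        R₁ _ = row

        C₁ : Matrix n 1
        C₁ i _ = col i

        rT : Fin n → Carrier
        rT j = (R₁ *ᴹ T) zero j

        Tc : Fin n → Carrier
        Tc i = (T *ᴹ C₁) i zero

        rTc : Carrier
        rTc = sum (λ l → rT l * col l)

        N : Matrix (suc n) (suc n)
        N zero    zero    = e + e * rTc * e
        N zero    (suc j) = e * rT j
        N (suc i) zero    = Tc i * e
        N (suc i) (suc j) = T i j

        split : ∀ (U : Matrix k n) i j →
                (U *ᴹ (t ·I- D)) i j ≈
                (U *ᴹ (t ·I- D+cer)) i j + (U *ᴹ C₁) i zero * (e * row j)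
        split U i j = begin
          sum (λ l → U i l * (t * Iᴹ l j - D l j))
            ≈⟨ sum-cong-≋ (λ l → pointwise (U i l) (t * Iᴹ l j) (D l j) (col l) (e * row j)) ⟩
          sum (λ l → U i l * (t * Iᴹ l j - D+cer l j) + U i l * col l * (e * row j))
            ≈⟨ ∑-distrib-+ (λ l → U i l * (t * Iᴹ l j - D+cer l j)) _ ⟩
          (U *ᴹ (t ·I- D+cer)) i j + sum (λ l → U i l * col l * (e * row j))
            ≈⟨ +-congˡ (*-distribʳ-sum (e * row j) (λ l → U i l * col l)) ⟨
          (U *ᴹ (t ·I- D+cer)) i j + (U *ᴹ C₁) i zero * (e * row j) ∎
          where
          pointwise : ∀ u a d c r → u * (a - d) ≈ u * (a - (d + c * r)) + u * c * r
          pointwise u a d c r = begin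
            u * (a - d)
              ≈⟨ *-congˡ (trans (sym (+-identityʳ _)) (+-congˡ (sym (-‿inverseˡ (c * r))))) ⟩
            u * (a - d + (- (c * r) + c * r))
              ≈⟨ S.solve 6 (λ u a d x c r →
                   (u S.:* (a S.:+ d S.:+ (x S.:+ c S.:* r))) S.:=
                   (u S.:* (a S.:+ (d S.:+ x)) S.:+ u S.:* c S.:* r))
                   refl u a (- d) (- (c * r)) c r ⟩
            u * (a + (- d - c * r)) + u * c * r
              ≈⟨ +-congʳ (*-congˡ (+-congˡ (-‿+-comm d (c * r)))) ⟩
            u * (a - (d + c * r)) + u * c * r ∎

        -- The entries of t·I - P outside the diagonal blocks.
        off : ∀ q → t * 0# - q ≈ - q
        off q = trans (+-congʳ (zeroʳ t)) (+-identityˡ (- q))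

        corner : t * 1# - p ≈ t - p
        corner = +-congʳ (*-identityʳ t)

        sum-neg : (U : Fin n → Carrier) →
                  sum (λ l → U l * (t * 0# - col l)) ≈ - sum (λ l → U l * col l)
        sum-neg U = begin
          sum (λ l → U l * (t * 0# - col l))
            ≈⟨ sum-cong-≋ (λ l → trans (*-congˡ (off (col l)))
                 (trans (sym (-‿distribʳ-* _ _))
                   (trans (-‿cong (sym (*-identityˡ _))) (-‿distribˡ-* 1# _)))) ⟩
          sum (λ l → - 1# * (U l * col l))
            ≈⟨ *-distribˡ-sum (- 1#) (λ l → U l * col l) ⟨
          - 1# * sum (λ l → U l * col l)
            ≈⟨ sym (-‿distribˡ-* 1# _) ⟩
          - (1# * sum (λ l → U l * col l))
            ≈⟨ -‿cong (*-identityˡ _) ⟩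
          - sum (λ l → U l * col l) ∎

        rTS≈r : ∀ j → (R₁ *ᴹ T *ᴹ (t ·I- D+cer)) zero j ≈ row j
        rTS≈r j = begin
          (R₁ *ᴹ T *ᴹ (t ·I- D+cer)) zero j    ≈⟨ *ᴹ-assoc R₁ T (t ·I- D+cer) zero j ⟩
          (R₁ *ᴹ (T *ᴹ (t ·I- D+cer))) zero j  ≈⟨ *ᴹ-congˡ R₁ TS≈I zero j ⟩
          (R₁ *ᴹ Iᴹ) zero j                    ≈⟨ *ᴹ-identityʳ R₁ zero j ⟩
          row j                                ∎

        pull : ∀ x (f g : Fin n → Carrier) →
               sum (λ l → x * f l * g l) ≈ x * sum (λ l → f l * g l)
        pull x f g = trans (sum-cong-≋ (λ l → *-assoc x (f l) (g l)))
                           (sym (*-distribˡ-sum x (λ l → f l * g l)))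

        proof : N *ᴹ (t ·I- P) ≈ᴹ Iᴹ
        proof zero zero = begin
          (e + e * rTc * e) * (t * 1# - p) + sum (λ l → e * rT l * (t * 0# - col l))
            ≈⟨ +-cong (*-congˡ corner)
                 (trans (pull e rT _) (*-congˡ (sum-neg rT))) ⟩
          (e + e * rTc * e) * (t - p) + e * (- rTc)
            ≈⟨ S.solve 4 (λ e x u v →
                 ((e S.:+ e S.:* x S.:* e) S.:* u S.:+ e S.:* v) S.:=
                 (e S.:* u S.:+ e S.:* (x S.:* (e S.:* u) S.:+ v)))
                 refl e rTc (t - p) (- rTc) ⟩
          e * (t - p) + e * (rTc * (e * (t - p)) - rTc)
            ≈⟨ +-cong e[t-p]≈1 (*-congˡ (+-congʳ (trans (*-congˡ e[t-p]≈1) (*-identityʳ _)))) ⟩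
          1# + e * (rTc - rTc)
            ≈⟨ +-congˡ (trans (*-congˡ (-‿inverseʳ rTc)) (zeroʳ e)) ⟩
          1# + 0#
            ≈⟨ +-identityʳ 1# ⟩
          1# ∎
        proof zero (suc j) = begin
          (e + e * rTc * e) * (t * 0# - row j) + sum (λ l → e * rT l * (t ·I- D) l j)
            ≈⟨ +-cong (*-congˡ (off (row j)))
                 (trans (pull e rT (λ l → (t ·I- D) l j)) (*-congˡ (split (R₁ *ᴹ T) zero j))) ⟩
          (e + e * rTc * e) * (- row j) +
            e * ((R₁ *ᴹ T *ᴹ (t ·I- D+cer)) zero j + rTc * (e * row j))
            ≈⟨ +-cong (sym (-‿distribʳ-* _ _)) (*-congˡ (+-congʳ (rTS≈r j))) ⟩
          - ((e + e * rTc * e) * row j) + e * (row j + rTc * (e * row j))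
            ≈⟨ +-congˡ (S.solve 3 (λ e x r →
                 (e S.:* (r S.:+ x S.:* (e S.:* r))) S.:=
                 ((e S.:+ e S.:* x S.:* e) S.:* r)) refl e rTc (row j)) ⟩
          - ((e + e * rTc * e) * row j) + (e + e * rTc * e) * row j
            ≈⟨ -‿inverseˡ _ ⟩
          0# ∎
        proof (suc i) zero = begin
          Tc i * e * (t * 1# - p) + sum (λ l → T i l * (t * 0# - col l))
            ≈⟨ +-cong (trans (*-congˡ corner) (trans (*-assoc _ _ _)
                 (trans (*-congˡ e[t-p]≈1) (*-identityʳ _)))) (sum-neg (T i)) ⟩
          Tc i - Tc i
            ≈⟨ -‿inverseʳ _ ⟩
          0# ∎
        proof (suc i) (suc j) = begin
          Tc i * e * (t * 0# - row j) + sum (λ l → T i l * (t ·I- D) l j)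
            ≈⟨ +-cong (trans (*-congˡ (off (row j))) (trans (sym (-‿distribʳ-* _ _))
                 (-‿cong (*-assoc _ _ _)))) (split T i j) ⟩
          - (Tc i * (e * row j)) +
            ((T *ᴹ (t ·I- D+cer)) i j + Tc i * (e * row j))
            ≈⟨ +-congˡ (+-comm _ _) ⟩
          - (Tc i * (e * row j)) +
            (Tc i * (e * row j) + (T *ᴹ (t ·I- D+cer)) i j)
            ≈⟨ cancel _ _ ⟩
          (T *ᴹ (t ·I- D+cer)) i j
            ≈⟨ TS≈I i j ⟩
          Iᴹ i j ∎

    inverse-·I- : (P : Matrix n n) → (∀ i j → O (P i j)) → Inverse (t ·I- P)
    inverse-·I- {n} P P∈O = record
      { matrix   = N
      ; inverseˡ = NA≈I
      ; inverseʳ = λ i j → trans (*ᴹ-congˡ A N≈N′ i j) (AN′≈I i j)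
      }
      where
      A  = t ·I- P
      N  = proj₁ (leftInverse P P∈O)
      NA≈I = proj₂ (leftInverse P P∈O)
      right = leftInverse (transpose P) (flip P∈O)
      N′ : Matrix n n
      N′ = transpose (proj₁ right)

      AN′≈I : A *ᴹ N′ ≈ᴹ Iᴹ
      AN′≈I i j = begin
        (A *ᴹ N′) i j
          ≈⟨ transpose-*ᴹ A N′ j i ⟩
        (proj₁ right *ᴹ transpose A) j i
          ≈⟨ *ᴹ-congˡ (proj₁ right) (λ a b → +-congʳ {x = - P b a} (*-congˡ (Iᴹ-symmetric b a))) j i ⟩
        (proj₁ right *ᴹ (t ·I- transpose P)) j i
          ≈⟨ proj₂ right j i ⟩
        Iᴹ j i
          ≈⟨ Iᴹ-symmetric j i ⟩
        Iᴹ i j ∎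

      N≈N′ : N ≈ᴹ N′
      N≈N′ i j = begin
        N i j                ≈⟨ *ᴹ-identityʳ N i j ⟨
        (N *ᴹ Iᴹ) i j        ≈⟨ *ᴹ-congˡ N AN′≈I i j ⟨
        (N *ᴹ (A *ᴹ N′)) i j ≈⟨ *ᴹ-assoc N A N′ i j ⟨
        (N *ᴹ A *ᴹ N′) i j   ≈⟨ *ᴹ-congʳ N′ NA≈I i j ⟩
        (Iᴹ *ᴹ N′) i j       ≈⟨ *ᴹ-identityˡ N′ i j ⟩
        N′ i j               ∎

------------------------------------------------------------------------
-- Polynomials in one variable, as coefficient lists (constant term
-- first, trailing zeros allowed)

module Polynomials (R : CommutativeRing c ℓ) where

  open CommutativeRing R hiding (zero)
  open RingProperties ring using (-0#≈0#)
  infix  4 _≈ₚ_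
  infixl 6 _+ₚ_
  infixl 7 _*ₚ_ _·ₚ_
  infix  8 -ₚ_

  Polynomial : Set c
  Polynomial = List Carrier

  coeff : Polynomial → ℕ → Carrier
  coeff []      _       = 0#
  coeff (a ∷ p) zero    = a
  coeff (a ∷ p) (suc i) = coeff p i

  record _≈ₚ_ (p q : Polynomial) : Set ℓ where
    constructor coeffwise
    field coeff-≈ : ∀ i → coeff p i ≈ coeff q i

  open _≈ₚ_ public

  _+ₚ_ : Polynomial → Polynomial → Polynomial
  []      +ₚ q       = q
  (a ∷ p) +ₚ []      = a ∷ p
  (a ∷ p) +ₚ (b ∷ q) = a + b ∷ p +ₚ q

  -ₚ_ : Polynomial → Polynomial
  -ₚ_ = map (-_)

  _·ₚ_ : Carrier → Polynomial → Polynomial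
  a ·ₚ p = map (a *_) p

  _*ₚ_ : Polynomial → Polynomial → Polynomial
  []      *ₚ q = []
  (a ∷ p) *ₚ q = a ·ₚ q +ₚ (0# ∷ p *ₚ q)

  constant : Carrier → Polynomial
  constant a = a ∷ []

  0ₚ 1ₚ X : Polynomial
  0ₚ = []
  1ₚ = constant 1#
  X  = 0# ∷ 1# ∷ []

  coeff-+ : ∀ p q i → coeff (p +ₚ q) i ≈ coeff p i + coeff q i
  coeff-+ []      q       i       = sym (+-identityˡ _)
  coeff-+ (a ∷ p) []      i       = sym (+-identityʳ _)
  coeff-+ (a ∷ p) (b ∷ q) zero    = refl
  coeff-+ (a ∷ p) (b ∷ q) (suc i) = coeff-+ p q i

  coeff-neg : ∀ p i → coeff (-ₚ p) i ≈ - coeff p i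
  coeff-neg []      i       = sym -0#≈0#
  coeff-neg (a ∷ p) zero    = refl
  coeff-neg (a ∷ p) (suc i) = coeff-neg p i

  coeff-· : ∀ a p i → coeff (a ·ₚ p) i ≈ a * coeff p i
  coeff-· a []      i       = sym (zeroʳ a)
  coeff-· a (b ∷ p) zero    = refl
  coeff-· a (b ∷ p) (suc i) = coeff-· a p i

  coeff-∷* : ∀ a p q i → coeff ((a ∷ p) *ₚ q) i ≈ a * coeff q i + coeff (0# ∷ p *ₚ q) i
  coeff-∷* a p q i = trans (coeff-+ (a ·ₚ q) _ i) (+-congʳ (coeff-· a q i))

  private
    ≈ₚ-refl : ∀ {p} → p ≈ₚ p
    ≈ₚ-refl = coeffwise λ i → refl

    ≈ₚ-sym : ∀ {p q} → p ≈ₚ q → q ≈ₚ p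
    ≈ₚ-sym p≈q = coeffwise λ i → sym (coeff-≈ p≈q i)

    ≈ₚ-trans : ∀ {p q r} → p ≈ₚ q → q ≈ₚ r → p ≈ₚ r
    ≈ₚ-trans p≈q q≈r = coeffwise λ i → trans (coeff-≈ p≈q i) (coeff-≈ q≈r i)

    +ₚ-cong : ∀ {p p′ q q′} → p ≈ₚ p′ → q ≈ₚ q′ → p +ₚ q ≈ₚ p′ +ₚ q′
    +ₚ-cong {p} {p′} {q} {q′} p≈ q≈ = coeffwise λ i →
      trans (coeff-+ p q i)
        (trans (+-cong (coeff-≈ p≈ i) (coeff-≈ q≈ i)) (sym (coeff-+ p′ q′ i)))

    +ₚ-comm : ∀ p q → p +ₚ q ≈ₚ q +ₚ p
    +ₚ-comm p q = coeffwise λ i →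
      trans (coeff-+ p q i) (trans (+-comm _ _) (sym (coeff-+ q p i)))

    +ₚ-assoc : ∀ p q r → (p +ₚ q) +ₚ r ≈ₚ p +ₚ (q +ₚ r)
    +ₚ-assoc p q r = coeffwise λ i →
      trans (coeff-+ (p +ₚ q) r i) (trans (+-congʳ (coeff-+ p q i))
        (trans (+-assoc _ _ _)
          (trans (+-congˡ (sym (coeff-+ q r i))) (sym (coeff-+ p (q +ₚ r) i)))))

    +ₚ-identityʳ : ∀ p → p +ₚ [] ≈ₚ p
    +ₚ-identityʳ p = +ₚ-comm p []

    -ₚ-cong : ∀ {p q} → p ≈ₚ q → -ₚ p ≈ₚ -ₚ q
    -ₚ-cong {p} {q} p≈q = coeffwise λ i →
      trans (coeff-neg p i) (trans (-‿cong (coeff-≈ p≈q i)) (sym (coeff-neg q i)))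

    -ₚ-inverseˡ : ∀ p → -ₚ p +ₚ p ≈ₚ []
    -ₚ-inverseˡ p = coeffwise λ i →
      trans (coeff-+ (-ₚ p) p i) (trans (+-congʳ (coeff-neg p i)) (-‿inverseˡ _))

    -ₚ-inverseʳ : ∀ p → p +ₚ -ₚ p ≈ₚ []
    -ₚ-inverseʳ p = ≈ₚ-trans (+ₚ-comm p (-ₚ p)) (-ₚ-inverseˡ p)

    +ₚ-commutativeMonoid : CommutativeMonoid c ℓ
    +ₚ-commutativeMonoid = record
      { isCommutativeMonoid = record
        { isMonoid = record
          { isSemigroup = record
            { isMagma = record
              { isEquivalence = record { refl = ≈ₚ-refl ; sym = ≈ₚ-sym ; trans = ≈ₚ-trans }
              ; ∙-cong = +ₚ-cong
              }
            ; assoc = +ₚ-assoc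
            }
          ; identity = (λ _ → ≈ₚ-refl) , +ₚ-identityʳ
          }
        ; comm = +ₚ-comm
        }
      }

    open CommutativeSemigroupProperties
      (CommutativeMonoid.commutativeSemigroup +ₚ-commutativeMonoid)
      using (interchange; x∙yz≈y∙xz)
    open SetoidReasoning (CommutativeMonoid.setoid +ₚ-commutativeMonoid)

    ∷-cong : ∀ {a b p q} → a ≈ b → p ≈ₚ q → a ∷ p ≈ₚ b ∷ q
    ∷-cong a≈b p≈q = coeffwise λ { zero → a≈b ; (suc i) → coeff-≈ p≈q i }

    shift-+ : ∀ p q → 0# ∷ p +ₚ q ≈ₚ (0# ∷ p) +ₚ (0# ∷ q)
    shift-+ p q = ∷-cong (sym (+-identityˡ 0#)) ≈ₚ-refl

    0∷[]≈[] : 0# ∷ [] ≈ₚ []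
    0∷[]≈[] = coeffwise λ { zero → refl ; (suc i) → refl }

    ·-cong : ∀ {a b p q} → a ≈ b → p ≈ₚ q → a ·ₚ p ≈ₚ b ·ₚ q
    ·-cong {a} {b} {p} {q} a≈b p≈q = coeffwise λ i →
      trans (coeff-· a p i) (trans (*-cong a≈b (coeff-≈ p≈q i)) (sym (coeff-· b q i)))

    ·-distribʳ : ∀ a b p → (a + b) ·ₚ p ≈ₚ a ·ₚ p +ₚ b ·ₚ p
    ·-distribʳ a b p = coeffwise λ i →
      trans (coeff-· (a + b) p i) (trans (distribʳ _ a b)
        (trans (sym (+-cong (coeff-· a p i) (coeff-· b p i)))
               (sym (coeff-+ (a ·ₚ p) (b ·ₚ p) i))))

    ·-distribˡ : ∀ a p q → a ·ₚ (p +ₚ q) ≈ₚ a ·ₚ p +ₚ a ·ₚ q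
    ·-distribˡ a p q = coeffwise λ i →
      trans (coeff-· a (p +ₚ q) i) (trans (*-congˡ (coeff-+ p q i)) (trans (distribˡ a _ _)
        (trans (sym (+-cong (coeff-· a p i) (coeff-· a q i)))
               (sym (coeff-+ (a ·ₚ p) (a ·ₚ q) i)))))

    ·-assoc : ∀ a b p → (a * b) ·ₚ p ≈ₚ a ·ₚ (b ·ₚ p)
    ·-assoc a b p = coeffwise λ i →
      trans (coeff-· (a * b) p i) (trans (*-assoc a b _)
        (trans (*-congˡ (sym (coeff-· b p i))) (sym (coeff-· a (b ·ₚ p) i))))

    ·-identity : ∀ p → 1# ·ₚ p ≈ₚ p
    ·-identity p = coeffwise λ i → trans (coeff-· 1# p i) (*-identityˡ _)

    ·-zero : ∀ p → 0# ·ₚ p ≈ₚ []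
    ·-zero p = coeffwise λ i → trans (coeff-· 0# p i) (zeroˡ _)

    shift-· : ∀ a p → a ·ₚ (0# ∷ p) ≈ₚ 0# ∷ a ·ₚ p
    shift-· a p = ∷-cong (zeroʳ a) ≈ₚ-refl

    ·-*-assoc : ∀ a p q → (a ·ₚ p) *ₚ q ≈ₚ a ·ₚ (p *ₚ q)
    ·-*-assoc a []      q = ≈ₚ-refl
    ·-*-assoc a (b ∷ p) q = begin
      (a * b) ·ₚ q +ₚ (0# ∷ (a ·ₚ p) *ₚ q)
        ≈⟨ +ₚ-cong (·-assoc a b q) (∷-cong refl (·-*-assoc a p q)) ⟩
      a ·ₚ (b ·ₚ q) +ₚ (0# ∷ a ·ₚ (p *ₚ q))
        ≈⟨ +ₚ-cong ≈ₚ-refl (shift-· a (p *ₚ q)) ⟨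
      a ·ₚ (b ·ₚ q) +ₚ a ·ₚ (0# ∷ p *ₚ q)
        ≈⟨ ·-distribˡ a (b ·ₚ q) (0# ∷ p *ₚ q) ⟨
      a ·ₚ (b ·ₚ q +ₚ (0# ∷ p *ₚ q)) ∎

    shift-* : ∀ p q → (0# ∷ p) *ₚ q ≈ₚ 0# ∷ p *ₚ q
    shift-* p q = +ₚ-cong (·-zero q) ≈ₚ-refl

    *ₚ-distribʳ : ∀ r p q → (p +ₚ q) *ₚ r ≈ₚ p *ₚ r +ₚ q *ₚ r
    *ₚ-distribʳ r []      q       = ≈ₚ-refl
    *ₚ-distribʳ r (a ∷ p) []      = ≈ₚ-sym (+ₚ-identityʳ _)
    *ₚ-distribʳ r (a ∷ p) (b ∷ q) = begin
      (a + b) ·ₚ r +ₚ (0# ∷ (p +ₚ q) *ₚ r)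
        ≈⟨ +ₚ-cong (·-distribʳ a b r)
             (≈ₚ-trans (∷-cong refl (*ₚ-distribʳ r p q)) (shift-+ (p *ₚ r) (q *ₚ r))) ⟩
      (a ·ₚ r +ₚ b ·ₚ r) +ₚ ((0# ∷ p *ₚ r) +ₚ (0# ∷ q *ₚ r))
        ≈⟨ interchange (a ·ₚ r) (b ·ₚ r) (0# ∷ p *ₚ r) (0# ∷ q *ₚ r) ⟩
      (a ·ₚ r +ₚ (0# ∷ p *ₚ r)) +ₚ (b ·ₚ r +ₚ (0# ∷ q *ₚ r)) ∎

    *ₚ-[] : ∀ p → p *ₚ [] ≈ₚ []
    *ₚ-[] []      = ≈ₚ-refl
    *ₚ-[] (a ∷ p) = ≈ₚ-trans (∷-cong refl (*ₚ-[] p)) 0∷[]≈[]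

    *ₚ-∷ : ∀ p b q → p *ₚ (b ∷ q) ≈ₚ b ·ₚ p +ₚ (0# ∷ p *ₚ q)
    *ₚ-∷ []      b q = ≈ₚ-sym 0∷[]≈[]
    *ₚ-∷ (a ∷ p) b q = ∷-cong (trans (+-identityʳ _) (trans (*-comm a b) (sym (+-identityʳ _)))) (begin
      a ·ₚ q +ₚ p *ₚ (b ∷ q)
        ≈⟨ +ₚ-cong ≈ₚ-refl (*ₚ-∷ p b q) ⟩
      a ·ₚ q +ₚ (b ·ₚ p +ₚ (0# ∷ p *ₚ q))
        ≈⟨ x∙yz≈y∙xz (a ·ₚ q) (b ·ₚ p) (0# ∷ p *ₚ q) ⟩
      b ·ₚ p +ₚ (a ·ₚ q +ₚ (0# ∷ p *ₚ q)) ∎)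

    *ₚ-comm : ∀ p q → p *ₚ q ≈ₚ q *ₚ p
    *ₚ-comm []      q = ≈ₚ-sym (*ₚ-[] q)
    *ₚ-comm (a ∷ p) q = begin
      a ·ₚ q +ₚ (0# ∷ p *ₚ q)  ≈⟨ +ₚ-cong ≈ₚ-refl (∷-cong refl (*ₚ-comm p q)) ⟩
      a ·ₚ q +ₚ (0# ∷ q *ₚ p)  ≈⟨ *ₚ-∷ q a p ⟨
      q *ₚ (a ∷ p)             ∎

    *ₚ-congˡ : ∀ p {q q′} → q ≈ₚ q′ → p *ₚ q ≈ₚ p *ₚ q′
    *ₚ-congˡ []      q≈ = ≈ₚ-refl
    *ₚ-congˡ (a ∷ p) q≈ = +ₚ-cong (·-cong refl q≈) (∷-cong refl (*ₚ-congˡ p q≈))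

    *ₚ-cong : ∀ {p p′ q q′} → p ≈ₚ p′ → q ≈ₚ q′ → p *ₚ q ≈ₚ p′ *ₚ q′
    *ₚ-cong {p} {p′} {q} {q′} p≈ q≈ = begin
      p *ₚ q    ≈⟨ *ₚ-congˡ p q≈ ⟩
      p *ₚ q′   ≈⟨ *ₚ-comm p q′ ⟩
      q′ *ₚ p   ≈⟨ *ₚ-congˡ q′ p≈ ⟩
      q′ *ₚ p′  ≈⟨ *ₚ-comm q′ p′ ⟩
      p′ *ₚ q′  ∎

    *ₚ-assoc : ∀ p q r → (p *ₚ q) *ₚ r ≈ₚ p *ₚ (q *ₚ r)
    *ₚ-assoc []      q r = ≈ₚ-refl
    *ₚ-assoc (a ∷ p) q r = begin
      (a ·ₚ q +ₚ (0# ∷ p *ₚ q)) *ₚ r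
        ≈⟨ *ₚ-distribʳ r (a ·ₚ q) (0# ∷ p *ₚ q) ⟩
      (a ·ₚ q) *ₚ r +ₚ (0# ∷ p *ₚ q) *ₚ r
        ≈⟨ +ₚ-cong (·-*-assoc a q r) (shift-* (p *ₚ q) r) ⟩
      a ·ₚ (q *ₚ r) +ₚ (0# ∷ (p *ₚ q) *ₚ r)
        ≈⟨ +ₚ-cong ≈ₚ-refl (∷-cong refl (*ₚ-assoc p q r)) ⟩
      a ·ₚ (q *ₚ r) +ₚ (0# ∷ p *ₚ (q *ₚ r)) ∎

    *ₚ-identityˡ : ∀ p → 1ₚ *ₚ p ≈ₚ p
    *ₚ-identityˡ p = begin
      1# ·ₚ p +ₚ (0# ∷ [])  ≈⟨ +ₚ-cong (·-identity p) 0∷[]≈[] ⟩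
      p +ₚ []               ≈⟨ +ₚ-identityʳ p ⟩
      p                     ∎

  polynomialRing : CommutativeRing c ℓ
  polynomialRing = record
    { Carrier = Polynomial
    ; _≈_ = _≈ₚ_
    ; _+_ = _+ₚ_
    ; _*_ = _*ₚ_
    ; -_  = -ₚ_
    ; 0#  = 0ₚ
    ; 1#  = 1ₚ
    ; isCommutativeRing = record
      { isRing = record
        { +-isAbelianGroup = record
          { isGroup = record
            { isMonoid = CommutativeMonoid.isMonoid +ₚ-commutativeMonoid
            ; inverse  = -ₚ-inverseˡ , -ₚ-inverseʳ
            ; ⁻¹-cong  = -ₚ-cong
            }
          ; comm = +ₚ-comm
          }
        ; *-cong     = *ₚ-cong
        ; *-assoc    = *ₚ-assoc
        ; *-identity = *ₚ-identityˡ , λ p → ≈ₚ-trans (*ₚ-comm p 1ₚ) (*ₚ-identityˡ p)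
        ; distrib    = (λ p q r → ≈ₚ-trans (*ₚ-comm p (q +ₚ r))
                         (≈ₚ-trans (*ₚ-distribʳ p q r)
                           (+ₚ-cong (*ₚ-comm q p) (*ₚ-comm r p))))
                     , *ₚ-distribʳ
        }
      ; *-comm = *ₚ-comm
      }
    }

  Bounded : Polynomial → ℕ → Set ℓ
  Bounded p d = ∀ i → d ℕ.< i → coeff p i ≈ 0#

  Bounded-+ : ∀ {p q d} → Bounded p d → Bounded q d → Bounded (p +ₚ q) d
  Bounded-+ {p} {q} p≤ q≤ i d<i =
    trans (coeff-+ p q i) (trans (+-cong (p≤ i d<i) (q≤ i d<i)) (+-identityˡ 0#))

  Bounded-neg : ∀ {p d} → Bounded p d → Bounded (-ₚ p) d
  Bounded-neg {p} p≤ i d<i = trans (coeff-neg p i) (trans (-‿cong (p≤ i d<i)) -0#≈0#)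

  Bounded-* : ∀ p {q d e} → Bounded p d → Bounded q e →
              Bounded (p *ₚ q) (d ℕ.+ e) ×
              coeff (p *ₚ q) (d ℕ.+ e) ≈ coeff p d * coeff q e
  Bounded-* []      p≤ q≤ = (λ _ _ → refl) , sym (zeroˡ _)
  Bounded-* (a ∷ p) {q} {zero} {e} p≤ q≤ = bound , top
    where
    p≈[] : p ≈ₚ []
    p≈[] = coeffwise λ i → p≤ (suc i) (s≤s z≤n)

    tail≈0 : ∀ i → coeff (0# ∷ p *ₚ q) i ≈ 0#
    tail≈0 zero    = refl
    tail≈0 (suc i) = coeff-≈ (*ₚ-cong p≈[] (≈ₚ-refl {q})) i

    head : ∀ i → coeff ((a ∷ p) *ₚ q) i ≈ a * coeff q i
    head i = trans (coeff-∷* a p q i) (trans (+-congˡ (tail≈0 i)) (+-identityʳ _))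

    bound : Bounded ((a ∷ p) *ₚ q) e
    bound i e<i = trans (head i) (trans (*-congˡ (q≤ i e<i)) (zeroʳ a))

    top = head e
  Bounded-* (a ∷ p) {q} {suc d} {e} p≤ q≤ = bound , top
    where
    ih = Bounded-* p {q} {d} {e} (λ i d<i → p≤ (suc i) (s≤s d<i)) q≤

    tail : ∀ i → e ℕ.< suc i → coeff ((a ∷ p) *ₚ q) (suc i) ≈ coeff (p *ₚ q) i
    tail i e<i = trans (coeff-∷* a p q (suc i))
      (trans (+-congʳ (trans (*-congˡ (q≤ (suc i) e<i)) (zeroʳ a))) (+-identityˡ _))

    bound : Bounded ((a ∷ p) *ₚ q) (suc d ℕ.+ e)
    bound (suc i) (s≤s d+e<i) =
      trans (tail i (s≤s (ℕₚ.≤-trans (ℕₚ.m≤n+m e d) (ℕₚ.<⇒≤ d+e<i)))) (proj₁ ih i d+e<i)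

    top = trans (tail (d ℕ.+ e) (s≤s (ℕₚ.m≤n+m e d))) (proj₂ ih)

------------------------------------------------------------------------
-- Fractions with denominators in a multiplicative set of cancellable
-- elements

module Fractions
  {c ℓ s : Level}
  (R : CommutativeRing c ℓ)
  (S : CommutativeRing.Carrier R → Set s)
  (S-1 : S (CommutativeRing.1# R))
  (S-* : ∀ a b → S a → S b → S (CommutativeRing._*_ R a b))
  (S-cancel : ∀ d → S d → ∀ a b →
    CommutativeRing._≈_ R (CommutativeRing._*_ R d a) (CommutativeRing._*_ R d b) →
    CommutativeRing._≈_ R a b)
  where

  open CommutativeRing R
  open RingProperties ring using (-‿distribˡ-*)
  open SetoidReasoning setoid
  private module Sol = SemiringSolver commutativeSemiring
  open Sol using (_:=_; _:+_; _:*_; con)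

  record Fraction : Set (c ⊔ s) where
    no-eta-equality
    pattern
    constructor mkFraction
    field
      num   : Carrier
      den   : Carrier
      den∈S : S den

  open Fraction public

  infix 4 _≈ᶠ_

  record _≈ᶠ_ (a b : Fraction) : Set ℓ where
    constructor cross
    field uncross : num a * den b ≈ num b * den a

  open _≈ᶠ_ public

  infixl 6 _+ᶠ_
  infixl 7 _*ᶠ_
  infix  8 -ᶠ_

  _+ᶠ_ _*ᶠ_ : Fraction → Fraction → Fraction
  mkFraction a b b∈S +ᶠ mkFraction a′ b′ b′∈S =
    mkFraction (a * b′ + a′ * b) (b * b′) (S-* b b′ b∈S b′∈S)
  mkFraction a b b∈S *ᶠ mkFraction a′ b′ b′∈S =
    mkFraction (a * a′) (b * b′) (S-* b b′ b∈S b′∈S)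

  -ᶠ_ : Fraction → Fraction
  -ᶠ mkFraction a b b∈S = mkFraction (- a) b b∈S

  embed : Carrier → Fraction
  embed a = mkFraction a 1# S-1

  private
    ≈ᶠ-trans : ∀ {x y z} → x ≈ᶠ y → y ≈ᶠ z → x ≈ᶠ z
    ≈ᶠ-trans {mkFraction a b _} {mkFraction a′ b′ b′∈S} {mkFraction a″ b″ _} (cross p) (cross q) =
      cross (S-cancel b′ b′∈S _ _ (begin
        b′ * (a * b″)   ≈⟨ Sol.solve 3 (λ x y z → x :* (y :* z) := (y :* x) :* z) refl b′ a b″ ⟩
        a * b′ * b″     ≈⟨ *-congʳ p ⟩
        a′ * b * b″     ≈⟨ Sol.solve 3 (λ x y z → x :* y :* z := (x :* z) :* y) refl a′ b b″ ⟩
        a′ * b″ * b     ≈⟨ *-congʳ q ⟩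
        a″ * b′ * b     ≈⟨ Sol.solve 3 (λ x y z → x :* y :* z := y :* (x :* z)) refl a″ b′ b ⟩
        b′ * (a″ * b)   ∎))

    +ᶠ-cong : ∀ {x x′ y y′} → x ≈ᶠ x′ → y ≈ᶠ y′ → x +ᶠ y ≈ᶠ x′ +ᶠ y′
    +ᶠ-cong {mkFraction a b _} {mkFraction a′ b′ _} {mkFraction u v _} {mkFraction u′ v′ _}
      (cross p) (cross q) = cross (begin
        (a * v + u * b) * (b′ * v′)
          ≈⟨ Sol.solve 6 (λ a b b′ u v v′ → (a :* v :+ u :* b) :* (b′ :* v′) :=
               (a :* b′) :* (v :* v′) :+ (u :* v′) :* (b :* b′)) refl a b b′ u v v′ ⟩
        a * b′ * (v * v′) + u * v′ * (b * b′)
          ≈⟨ +-cong (*-congʳ p) (*-congʳ q) ⟩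
        a′ * b * (v * v′) + u′ * v * (b * b′)
          ≈⟨ Sol.solve 6 (λ a′ b b′ u′ v v′ → (a′ :* b) :* (v :* v′) :+ (u′ :* v) :* (b :* b′) :=
               (a′ :* v′ :+ u′ :* b′) :* (b :* v)) refl a′ b b′ u′ v v′ ⟩
        (a′ * v′ + u′ * b′) * (b * v) ∎)

    *ᶠ-cong : ∀ {x x′ y y′} → x ≈ᶠ x′ → y ≈ᶠ y′ → x *ᶠ y ≈ᶠ x′ *ᶠ y′
    *ᶠ-cong {mkFraction a b _} {mkFraction a′ b′ _} {mkFraction u v _} {mkFraction u′ v′ _}
      (cross p) (cross q) = cross (begin
        a * u * (b′ * v′)
          ≈⟨ Sol.solve 4 (λ a u b v → a :* u :* (b :* v) := (a :* b) :* (u :* v)) refl a u b′ v′ ⟩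
        a * b′ * (u * v′)
          ≈⟨ *-cong p q ⟩
        a′ * b * (u′ * v)
          ≈⟨ Sol.solve 4 (λ a b u v → a :* b :* (u :* v) := (a :* u) :* (b :* v)) refl a′ b u′ v ⟩
        a′ * u′ * (b * v) ∎)

    -ᶠ-cong : ∀ {x y} → x ≈ᶠ y → -ᶠ x ≈ᶠ -ᶠ y
    -ᶠ-cong {mkFraction _ _ _} {mkFraction _ _ _} (cross p) = cross
      (trans (sym (-‿distribˡ-* _ _)) (trans (-‿cong p) (-‿distribˡ-* _ _)))

    -ᶠ-inverseˡ : ∀ x → -ᶠ x +ᶠ x ≈ᶠ embed 0#
    -ᶠ-inverseˡ (mkFraction a b _) = cross (begin
      (- a * b + a * b) * 1#
        ≈⟨ *-congʳ (trans (sym (distribʳ b (- a) a)) (*-congʳ (-‿inverseˡ a))) ⟩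
      0# * b * 1#
        ≈⟨ trans (*-identityʳ _) (trans (zeroˡ b) (sym (zeroˡ (b * b)))) ⟩
      0# * (b * b) ∎)

    +ᶠ-comm : ∀ x y → x +ᶠ y ≈ᶠ y +ᶠ x
    +ᶠ-comm (mkFraction a b _) (mkFraction u v _) = cross
      (Sol.solve 4 (λ a b u v → (a :* v :+ u :* b) :* (v :* b) :=
        (u :* b :+ a :* v) :* (b :* v)) refl a b u v)

    *ᶠ-comm : ∀ x y → x *ᶠ y ≈ᶠ y *ᶠ x
    *ᶠ-comm (mkFraction a b _) (mkFraction u v _) = cross (*-cong (*-comm a u) (*-comm v b))

    +ᶠ-assoc : ∀ x y z → (x +ᶠ y) +ᶠ z ≈ᶠ x +ᶠ (y +ᶠ z)
    +ᶠ-assoc (mkFraction a b _) (mkFraction u v _) (mkFraction w z _) = cross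
      (Sol.solve 6 (λ a b u v w z →
        ((a :* v :+ u :* b) :* z :+ w :* (b :* v)) :* (b :* (v :* z)) :=
        (a :* (v :* z) :+ (u :* z :+ w :* v) :* b) :* (b :* v :* z)) refl a b u v w z)

    *ᶠ-assoc : ∀ x y z → (x *ᶠ y) *ᶠ z ≈ᶠ x *ᶠ (y *ᶠ z)
    *ᶠ-assoc (mkFraction a b _) (mkFraction u v _) (mkFraction w z _) = cross
      (*-cong (*-assoc a u w) (sym (*-assoc b v z)))

    +ᶠ-identityˡ : ∀ x → embed 0# +ᶠ x ≈ᶠ x
    +ᶠ-identityˡ (mkFraction a b _) = cross
      (Sol.solve 2 (λ a b → (con 0 :* b :+ a :* con 1) :* b := a :* (con 1 :* b)) refl a b)

    *ᶠ-identityˡ : ∀ x → embed 1# *ᶠ x ≈ᶠ x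
    *ᶠ-identityˡ (mkFraction a b _) = cross
      (Sol.solve 2 (λ a b → (con 1 :* a) :* b := a :* (con 1 :* b)) refl a b)

    *ᶠ-distribʳ : ∀ x y z → (y +ᶠ z) *ᶠ x ≈ᶠ y *ᶠ x +ᶠ z *ᶠ x
    *ᶠ-distribʳ (mkFraction a b _) (mkFraction u v _) (mkFraction w z _) = cross
      (Sol.solve 6 (λ a b u v w z →
        ((u :* z :+ w :* v) :* a) :* ((v :* b) :* (z :* b)) :=
        ((u :* a) :* (z :* b) :+ (w :* a) :* (v :* b)) :* ((v :* z) :* b)) refl a b u v w z)

  fractionRing : CommutativeRing (c ⊔ s) ℓ
  fractionRing = record
    { Carrier = Fraction
    ; _≈_ = _≈ᶠ_
    ; _+_ = _+ᶠ_
    ; _*_ = _*ᶠ_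
    ; -_  = -ᶠ_
    ; 0#  = embed 0#
    ; 1#  = embed 1#
    ; isCommutativeRing = record
      { isRing = record
        { +-isAbelianGroup = record
          { isGroup = record
            { isMonoid = record
              { isSemigroup = record
                { isMagma = record
                  { isEquivalence = record
                    { refl  = cross refl
                    ; sym   = λ where (cross p) → cross (sym p)
                    ; trans = ≈ᶠ-trans
                    }
                  ; ∙-cong = +ᶠ-cong
                  }
                ; assoc = +ᶠ-assoc
                }
              ; identity = +ᶠ-identityˡ , λ x → ≈ᶠ-trans (+ᶠ-comm x (embed 0#)) (+ᶠ-identityˡ x)
              }
            ; inverse = -ᶠ-inverseˡ , λ x → ≈ᶠ-trans (+ᶠ-comm x (-ᶠ x)) (-ᶠ-inverseˡ x)
            ; ⁻¹-cong = -ᶠ-cong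
            }
          ; comm = +ᶠ-comm
          }
        ; *-cong     = *ᶠ-cong
        ; *-assoc    = *ᶠ-assoc
        ; *-identity = *ᶠ-identityˡ , λ x → ≈ᶠ-trans (*ᶠ-comm x (embed 1#)) (*ᶠ-identityˡ x)
        ; distrib    = (λ x y z → ≈ᶠ-trans (*ᶠ-comm x (y +ᶠ z))
                         (≈ᶠ-trans (*ᶠ-distribʳ x y z)
                           (+ᶠ-cong (*ᶠ-comm y x) (*ᶠ-comm z x))))
                     , *ᶠ-distribʳ
        }
      ; *-comm = *ᶠ-comm
      }
    }

------------------------------------------------------------------------
-- Rational functions over a field
--
-- K stands for a field containing the eigenvalues of the matrices
-- considered, for instance the real numbers; these have no decidable
-- equality, hence the apartness.

module RationalFunctions (K : HeytingField c ℓ₁ ℓ₂) where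

  private
    module K where
      open HeytingField K public
      open HeytingProperties heytingCommutativeRing public

    open Polynomials (HeytingCommutativeRing.commutativeRing K.heytingCommutativeRing)
    module K[X] = CommutativeRing polynomialRing

  NonZeroₚ : Polynomial → Set ℓ₂
  NonZeroₚ p = ∃ λ i → coeff p i K.# K.0#

  summand-# : ∀ {a b e} → e K.≈ a K.+ b → b K.# K.0# → (e K.# K.0#) ⊎ (a K.# K.0#)
  summand-# {a} {b} {e} e≈a+b b#0 =
    Sum.swap (Sum.map (a#0 ∘ K.#-sym) id (K.#-cotrans b#0 e))
    where
    open SetoidReasoning K.setoid

    e-b≈a : e K.- b K.≈ a K.- K.0#
    e-b≈a = begin
      e K.- b            ≈⟨ K.+-congʳ e≈a+b ⟩
      a K.+ b K.- b      ≈⟨ K.+-assoc a b (K.- b) ⟩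
      a K.+ (b K.- b)    ≈⟨ K.+-congˡ (K.-‿inverseʳ b) ⟩
      a K.+ K.0#         ≈⟨ K.+-identityʳ a ⟩
      a                  ≈⟨ K.x-0≈x a ⟨
      a K.- K.0#         ∎

    a#0 : e K.# b → a K.# K.0#
    a#0 e#b with K.#⇒invertible e#b
    ... | u , u[e-b]≈1 , _ =
      K.invertibleˡ⇒# (u , K.trans (K.*-congˡ (K.sym e-b≈a)) u[e-b]≈1)

  factor-# : ∀ {a b} → a K.* b K.# K.0# → a K.# K.0#
  factor-# {a} {b} ab#0 with K.#⇒invertible ab#0
  ... | u , _ , [ab-0]u≈1 = K.invertibleʳ⇒# (b K.* u , (begin
    (a K.- K.0#) K.* (b K.* u)  ≈⟨ K.*-congʳ (K.x-0≈x a) ⟩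
    a K.* (b K.* u)             ≈⟨ K.*-assoc a b u ⟨
    a K.* b K.* u               ≈⟨ K.*-congʳ (K.x-0≈x _) ⟨
    (a K.* b K.- K.0#) K.* u    ≈⟨ [ab-0]u≈1 ⟩
    K.1#                        ∎))
    where open SetoidReasoning K.setoid

  -- Products with a polynomial whose constant term is invertible.
  NonZero-∷* : ∀ {a} p q → a K.# K.0# → NonZeroₚ q → NonZeroₚ ((a ∷ p) *ₚ q)
  NonZero-∷* p []      a#0 (i , 0#0) = contradiction 0#0 (K.#-irrefl K.refl)
  NonZero-∷* {a} p (b ∷ q) a#0 (zero , b#0) =
    zero , K.#-congʳ (K.sym (K.+-identityʳ _)) (K.x#0y#0→xy#0 a#0 b#0)
  NonZero-∷* {a} p (b ∷ q) a#0 (suc i , q#0) with NonZero-∷* p q a#0 (i , q#0)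
  ... | j , apq#0 with summand-# {a = b K.* coeff (a ∷ p) (suc j)} expand apq#0
    where
    open SetoidReasoning K.setoid
    expand : coeff ((a ∷ p) *ₚ (b ∷ q)) (suc j) K.≈
             b K.* coeff (a ∷ p) (suc j) K.+ coeff ((a ∷ p) *ₚ q) j
    expand = begin
      coeff ((a ∷ p) *ₚ (b ∷ q)) (suc j)
        ≈⟨ coeff-≈ (K[X].*-comm (a ∷ p) (b ∷ q)) (suc j) ⟩
      coeff ((b ∷ q) *ₚ (a ∷ p)) (suc j)
        ≈⟨ coeff-∷* b q (a ∷ p) (suc j) ⟩
      b K.* coeff (a ∷ p) (suc j) K.+ coeff (q *ₚ (a ∷ p)) j
        ≈⟨ K.+-congˡ (coeff-≈ (K[X].*-comm q (a ∷ p)) j) ⟩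
      b K.* coeff (a ∷ p) (suc j) K.+ coeff ((a ∷ p) *ₚ q) j ∎
  ...   | inj₁ e#0 = suc j , e#0
  ...   | inj₂ ba#0 = zero , K.#-congʳ (K.sym (K.+-identityʳ _))
                               (K.x#0y#0→xy#0 a#0 (factor-# ba#0))

  NonZero-* : ∀ p q → NonZeroₚ p → NonZeroₚ q → NonZeroₚ (p *ₚ q)
  NonZero-* []      q (i , 0#0)     q#0 = contradiction 0#0 (K.#-irrefl K.refl)
  NonZero-* (a ∷ p) q (zero , a#0)  q#0 = NonZero-∷* p q a#0 q#0
  NonZero-* (a ∷ p) q (suc i , p#0) q#0 with NonZero-* p q (i , p#0) q#0
  ... | j , pq#0 with summand-# (coeff-∷* a p q (suc j)) pq#0
  ...   | inj₁ e#0  = suc j , e#0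
  ...   | inj₂ aq#0 = NonZero-∷* p q (factor-# aq#0) q#0

  NonZero-cancel : ∀ d → NonZeroₚ d → ∀ p q → d *ₚ p ≈ₚ d *ₚ q → p ≈ₚ q
  NonZero-cancel d d#0 p q dp≈dq = x∙y⁻¹≈ε⇒x≈y p q (coeffwise λ i →
    proj₁ (K.tight _ _) λ r#0 →
      let j , dr#0 = NonZero-* d r d#0 (i , r#0) in
      K.#-irrefl (coeff-≈ dr≈0 j) dr#0)
    where
    open RingProperties K[X].ring using (x[y-z]≈xy-xz; x∙y⁻¹≈ε⇒x≈y; x≈y⇒x∙y⁻¹≈ε)
    r = p +ₚ -ₚ q
    dr≈0 : d *ₚ r ≈ₚ 0ₚ
    dr≈0 = K[X].trans (x[y-z]≈xy-xz d p q) (x≈y⇒x∙y⁻¹≈ε dp≈dq)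

  open Fractions polynomialRing NonZeroₚ (zero , K.1#0) NonZero-* NonZero-cancel public

  open CommutativeRing fractionRing public hiding (zero)
  open Exponentiation semiring public using (_^_)
  open CommutativeMonoidSum *-commutativeMonoid public using () renaming (sum to ∏)
  open Matrices fractionRing public
    using (Matrix; _·I-_; det; _*ᴹ_; transpose; Inverse)

  private module Mᴷ = Matrices (HeytingCommutativeRing.commutativeRing K.heytingCommutativeRing)

  x : Fraction
  x = embed X

  const : K.Carrier → Fraction
  const a = embed (constant a)

  fromℕ : ℕ → Fraction
  fromℕ n = const (Mᴷ.fromℕ n)

  CharacteristicZero : Set ℓ₂
  CharacteristicZero = ∀ n → .{{NonZero n}} → Mᴷ.fromℕ n K.# K.0#

  private
    -- deg num ≤ d = deg den for some d.
    Proper : Fraction → Set _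
    Proper u = ∃ λ d → Bounded (num u) d × Bounded (den u) d × coeff (den u) d K.# K.0#

    Bounded-swap : ∀ {p} d e → Bounded p (e ℕ.+ d) → Bounded p (d ℕ.+ e)
    Bounded-swap {p} d e = ≡.subst (Bounded p) (ℕₚ.+-comm e d)

    Proper-+ : ∀ {u v} → Proper u → Proper v → Proper (u + v)
    Proper-+ {u@(mkFraction _ _ _)} {v@(mkFraction _ _ _)} (d , u≤ , du≤ , du#0) (e , v≤ , dv≤ , dv#0) = d ℕ.+ e
      , Bounded-+ {num u *ₚ den v} {num v *ₚ den u}
          (proj₁ (Bounded-* (num u) u≤ dv≤))
          (Bounded-swap {num v *ₚ den u} d e (proj₁ (Bounded-* (num v) v≤ du≤)))
      , proj₁ (Bounded-* (den u) du≤ dv≤)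
      , K.#-congʳ (K.sym (proj₂ (Bounded-* (den u) du≤ dv≤))) (K.x#0y#0→xy#0 du#0 dv#0)

    Proper-* : ∀ {u v} → Proper u → Proper v → Proper (u * v)
    Proper-* {u@(mkFraction _ _ _)} {v@(mkFraction _ _ _)} (d , u≤ , du≤ , du#0) (e , v≤ , dv≤ , dv#0) = d ℕ.+ e
      , proj₁ (Bounded-* (num u) u≤ v≤)
      , proj₁ (Bounded-* (den u) du≤ dv≤)
      , K.#-congʳ (K.sym (proj₂ (Bounded-* (den u) du≤ dv≤))) (K.x#0y#0→xy#0 du#0 dv#0)

    Proper-const : ∀ a → Proper (const a)
    Proper-const a = 0 , (λ { (suc i) _ → K.refl }) , (λ { (suc i) _ → K.refl }) , K.1#0

    -- 1 / (x - a - u/v) = v / ((x - a) v - u).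
    invert : ∀ a {u} → Proper u → Σ[ e ∈ Fraction ] Proper e × e * (x - const a - u) ≈ 1#
    invert a {u@(mkFraction _ _ _)} (d , u≤ , v≤ , v#0) =
      e , (suc d , (λ i d<i → v≤ i (ℕₚ.<⇒≤ d<i)) , w≤ , w#0) , e[t-u]≈1
      where
      v = den u

      T : Polynomial
      T = K.- a ∷ K.1# ∷ []

      T≤ : Bounded T 1
      T≤ (suc zero)    (s≤s ())
      T≤ (suc (suc i)) _ = K.refl

      Tv = Bounded-* T {v} {1} {d} T≤ v≤
      -u≤ = Bounded-neg {num u} u≤

      w : Polynomial
      w = T *ₚ v +ₚ -ₚ num u

      w≤ : Bounded w (suc d)
      w≤ = Bounded-+ {T *ₚ v} {(-ₚ num u)} (proj₁ Tv) (λ i d<i → -u≤ i (ℕₚ.<⇒≤ d<i))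

      w#0 : coeff w (suc d) K.# K.0#
      w#0 = K.#-congʳ (K.sym top) v#0
        where
        open SetoidReasoning K.setoid
        top : coeff w (suc d) K.≈ coeff v d
        top = begin
          coeff w (suc d)
            ≈⟨ coeff-+ (T *ₚ v) (-ₚ num u) (suc d) ⟩
          coeff (T *ₚ v) (suc d) K.+ coeff (-ₚ num u) (suc d)
            ≈⟨ K.+-cong (proj₂ Tv) (-u≤ (suc d) ℕₚ.≤-refl) ⟩
          K.1# K.* coeff v d K.+ K.0#
            ≈⟨ K.trans (K.+-identityʳ _) (K.*-identityˡ _) ⟩
          coeff v d ∎

      e : Fraction
      e = mkFraction v w (suc d , w#0)

      module Sol = SemiringSolver K[X].commutativeSemiring
      open Sol using (_:=_; _:+_; _:*_; con)

      X-a≈T : X +ₚ -ₚ constant a ≈ₚ T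
      X-a≈T = coeffwise λ where
        zero    → K.+-identityˡ (K.- a)
        (suc i) → K.refl

      t≈T : x - const a ≈ embed T
      t≈T = cross (K[X].trans
        (Sol.solve 2 (λ y z → (y :* con 1 :+ z :* con 1) :* con 1 := (y :+ z) :* (con 1 :* con 1))
          K[X].refl X (-ₚ constant a))
        (K[X].*-congʳ {1ₚ *ₚ 1ₚ} X-a≈T))

      e[t-u]≈1 : e * (x - const a - u) ≈ 1#
      e[t-u]≈1 = trans (*-congˡ {e} (+-congʳ {x = -ᶠ u} t≈T)) (cross
        (Sol.solve 3 (λ T v z → (v :* (T :* v :+ z :* con 1)) :* con 1 :=
          con 1 :* ((T :* v :+ z) :* (con 1 :* v))) K[X].refl T v (-ₚ num u)))

  lift : Mᴷ.Matrix m n → Matrix m n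
  lift M i j = const (M i j)

  -- det (t·I - M).
  f : Mᴷ.Matrix n n → Fraction → Fraction
  f M t = det (t ·I- lift M)

  -- 1ᵀ (t·I - M)⁻¹ 1.  Two-sided inverses are unique up to _≈_, so the
  -- value does not depend on the inverse supplied.
  coronal : (M : Mᴷ.Matrix n n) (t : Fraction) → Inverse (t ·I- lift M) → Fraction
  coronal {n} M t inverse = (transpose 𝟏 *ᴹ Inverse.matrix inverse *ᴹ 𝟏) zero zero
    where
    𝟏 : Matrix n 1
    𝟏 _ _ = 1#

  shiftedInverse : (M : Mᴷ.Matrix n n) (k : ℕ) → Inverse ((x - fromℕ k) ·I- lift M)
  shiftedInverse M k =
    Matrices.inverse-·I- fractionRing Proper
      (λ {u} {v} → Proper-+ {u} {v}) (λ {u} {v} → Proper-* {u} {v})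
      (x - fromℕ k) (λ {p} → invert (Mᴷ.fromℕ k) {p})
      (lift M) (λ i j → Proper-const (M i j))

  Q : Graph n → Mᴷ.Matrix n n
  Q = Mᴷ.signlessLaplacian

  -- The coronal of Q G at x - k.
  χ[_]⟨x-_⟩ : Graph n → ℕ → Fraction
  χ[ G ]⟨x- k ⟩ = coronal (Q G) (x - fromℕ k) (shiftedInverse (Q G) k)

  -- ν lists the eigenvalues of M with algebraic multiplicity.
  Eigenvalues : Mᴷ.Matrix n n → (Fin n → K.Carrier) → Set ℓ₁
  Eigenvalues M ν = f M x ≈ ∏ (λ i → x - const (ν i))

{-# OPTIONS --safe #-}

-- Ordering the vertices as a's and b's, with δ the identity and J the all-ones
-- matrix,
--
--   x - Q(G₁ ⊛ G₂) = [ α - A₁ ⊗ J      - I ⊗ J   ]     α = x - r₁ n₂ - n₂,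
--                    [  - I ⊗ J         I ⊗ D    ]     D = x - n₂ - Q(G₂).
--
-- Since J D⁻¹ J = χ J for the coronal χ of Q(G₂) at x - n₂, the Schur complement
-- of I ⊗ D is α - (A₁ + χ) ⊗ J.  The matrix (A₁ + χ) ⊗ J is U V for a pair of
-- matrices with V U = n₂ (A₁ + χ), so Sylvester's identity gives the determinant
-- α ^ (n₁ (n₂ - 1)) det (α - n₂ (A₁ + χ)), and α - n₂ (A₁ + χ) equals
-- (x - n₂ - n₂ χ) - n₂ Q(G₁).  Its determinant is found by substituting
-- (x - n₂ - n₂ χ) / n₂ for X in the factorisation of det (X - Q(G₁)).
--
-- Determinants are treated through the exterior algebra of Rⁿ: by Laplace
-- expansion, det A is the top coordinate of the product of the rows of A.

module Submission where

open import Defs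
open import Algebra.Apartness.Bundles using (HeytingField; HeytingCommutativeRing)
open import Algebra.Bundles using (CommutativeRing)
open import Algebra.Morphism.Structures using (IsRingHomomorphism; IsRingMonomorphism)
import Algebra.Apartness.Properties.HeytingCommutativeRing as HeytingProperties
import Algebra.Morphism.Construct.Composition as Composition
import Algebra.Properties.CommutativeMonoid.Sum as CommutativeMonoidSum
import Algebra.Properties.Ring as RingProperties
import Algebra.Properties.Semiring.Exp as Exponentiation
import Algebra.Properties.Semiring.Mult as Multiples
import Algebra.Properties.Semiring.Sum as SemiringSum
import Algebra.Solver.Ring.NaturalCoefficients.Default as SemiringSolver
open import Data.Bool.Base as Bool using (Bool; true; false; if_then_else_)
open import Data.Fin.Base
  using (Fin; zero; suc; toℕ; punchIn; _↑ˡ_; _↑ʳ_; splitAt; combine; quotient; remainder)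
open import Data.Fin.Properties
  using (_≟_; splitAt-↑ˡ; splitAt-↑ʳ; remQuot-combine; combine-remQuot)
open import Data.Fin.Subset using (Subset; ⊤; ⊥; ∣_∣)
open import Data.List.Base using ([]; _∷_)
open import Data.Nat.Base as ℕ using (ℕ; zero; suc; NonZero)
import Data.Nat.Properties as ℕₚ
open import Data.Product.Base using (_×_; _,_; proj₁; proj₂)
open import Data.Sum.Base using (inj₁; inj₂; [_,_]′)
open import Data.Vec.Base using ([]; _∷_; _++_; insertAt; tabulate)
open import Function.Base using (_∘_)
open import Level using (Level)
open import Relation.Binary.PropositionalEquality as ≡ using (_≡_)
import Relation.Binary.Reasoning.Setoid as SetoidReasoning
open import Relation.Nullary.Decidable.Core using (does)

-- Equality with zero is not decidable for rational functions, which serve here only as a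
-- commutative ring. Every division is therefore by an element or matrix whose inverse is handed
-- over as data: `N` for D, `e` for α, and an inverse of n₂, which characteristic zero provides. The
-- inverse of α has the same source as that of D: α = (x - n₂) - r₁ n₂ is a 1 × 1 instance of x - n₂
-- minus a matrix of constants. Laplace expansion along the first row hides how `det` reacts to row
-- operations. In the exterior algebra this is the relation v ∧ v = 0, and both Schur complements of
-- a block matrix follow from it; Sylvester's identity compares the two. The eigenvalues are known
-- through an identity at the variable x alone, while the value is wanted at an expression that
-- itself contains χ. So the identity has to be pulled back to polynomials before anything is
-- substituted.

private
  variable
    c ℓ c′ ℓ′ : Level
    k m n : ℕ

-- Determinants through the exterior algebra

module Determinants (R : CommutativeRing c ℓ) where

  open CommutativeRing R hiding (zero)
  open Matrices R
  open SemiringSum semiring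
  open Exponentiation semiring using (_^_)
  open RingProperties ring
  open SetoidReasoning setoid
  private module S = SemiringSolver commutativeSemiring

  -- An element of the exterior algebra of Rⁿ is given by its coordinates: the
  -- set {i₁ < … < iₖ} stands for the basis vector e_{i₁} ∧ … ∧ e_{iₖ}.
  Form : ℕ → Set c
  Form n = Subset n → Carrier

  infixr 7 _∧_

  -- Write v = v₀ e₀ + v′ and η = η₀ + e₀ ∧ η₁ with η₀ and η₁ free of e₀; their coordinates are
  -- those at `false` and `true`. The e₀ part of v ∧ η is v₀ η₀ - v′ ∧ η₁, the sign coming from
  -- moving v′ past e₀.
  _∧_ : (Fin n → Carrier) → Form n → Form n
  (v ∧ η) []          = 0#
  (v ∧ η) (false ∷ s) = (v ∘ suc ∧ η ∘ (false ∷_)) s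
  (v ∧ η) (true ∷ s)  = v zero * η (false ∷ s) - (v ∘ suc ∧ η ∘ (true ∷_)) s

  unit : Form n
  unit []          = 1#
  unit (false ∷ s) = unit s
  unit (true ∷ s)  = 0#

  ⋀ : Matrix k n → Form n → Form n
  ⋀ {zero}  A η = η
  ⋀ {suc k} A η = A zero ∧ ⋀ (A ∘ suc) η

  ∧-cong : {v w : Fin n → Carrier} {η θ : Form n} →
           (∀ i → v i ≈ w i) → (∀ s → η s ≈ θ s) → ∀ s → (v ∧ η) s ≈ (w ∧ θ) s
  ∧-cong v≈w η≈θ []          = refl
  ∧-cong v≈w η≈θ (false ∷ s) = ∧-cong (v≈w ∘ suc) (η≈θ ∘ (false ∷_)) s
  ∧-cong v≈w η≈θ (true ∷ s)  =
    +-cong (*-cong (v≈w zero) (η≈θ (false ∷ s)))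
           (-‿cong (∧-cong (v≈w ∘ suc) (η≈θ ∘ (true ∷_)) s))

  ∧-congˡ : {v : Fin n → Carrier} {η θ : Form n} →
            (∀ s → η s ≈ θ s) → ∀ s → (v ∧ η) s ≈ (v ∧ θ) s
  ∧-congˡ = ∧-cong (λ _ → refl)

  ⋀-cong : {A B : Matrix k n} {η θ : Form n} →
           A ≈ᴹ B → (∀ s → η s ≈ θ s) → ∀ s → ⋀ A η s ≈ ⋀ B θ s
  ⋀-cong {zero}  A≈B η≈θ = η≈θ
  ⋀-cong {suc k} A≈B η≈θ = ∧-cong (A≈B zero) (⋀-cong (A≈B ∘ suc) η≈θ)

  x-0≈x : ∀ {x y} → y ≈ 0# → x - y ≈ x
  x-0≈x y≈0 = trans (+-congˡ (trans (-‿cong y≈0) -0#≈0#)) (+-identityʳ _)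

  ∧-zeroˡ : {v : Fin n → Carrier} (η : Form n) → (∀ i → v i ≈ 0#) → ∀ s → (v ∧ η) s ≈ 0#
  ∧-zeroˡ η v≈0 []          = refl
  ∧-zeroˡ η v≈0 (false ∷ s) = ∧-zeroˡ (η ∘ (false ∷_)) (v≈0 ∘ suc) s
  ∧-zeroˡ η v≈0 (true ∷ s)  =
    trans (x-0≈x (∧-zeroˡ (η ∘ (true ∷_)) (v≈0 ∘ suc) s))
          (trans (*-congʳ (v≈0 zero)) (zeroˡ _))

  ∧-zeroʳ : (v : Fin n → Carrier) {η : Form n} → (∀ s → η s ≈ 0#) → ∀ s → (v ∧ η) s ≈ 0#
  ∧-zeroʳ v η≈0 []          = refl
  ∧-zeroʳ v η≈0 (false ∷ s) = ∧-zeroʳ (v ∘ suc) (η≈0 ∘ (false ∷_)) s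
  ∧-zeroʳ v η≈0 (true ∷ s)  =
    trans (x-0≈x (∧-zeroʳ (v ∘ suc) (η≈0 ∘ (true ∷_)) s))
          (trans (*-congˡ (η≈0 (false ∷ s))) (zeroʳ _))

  a[x-y]+[z-w] : ∀ a x y z w → (a * x + z) - (a * y + w) ≈ a * (x - y) + (z - w)
  a[x-y]+[z-w] a x y z w = begin
    (a * x + z) - (a * y + w)
      ≈⟨ +-congˡ (trans (sym (-‿+-comm _ _)) (+-congʳ (-‿distribʳ-* a y))) ⟩
    (a * x + z) + (a * - y + - w)
      ≈⟨ S.solve 5 (λ a x y z w → ((a S.:* x S.:+ z) S.:+ (a S.:* y S.:+ w)) S.:=
                                 (a S.:* (x S.:+ y) S.:+ (z S.:+ w)))
           refl a x (- y) z (- w) ⟩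
    a * (x - y) + (z - w) ∎

  ∧-linearˡ : ∀ a (v w : Fin n → Carrier) (η : Form n) s →
              ((λ i → a * v i + w i) ∧ η) s ≈ a * (v ∧ η) s + (w ∧ η) s
  ∧-linearˡ a v w η [] = sym (trans (+-identityʳ _) (zeroʳ a))
  ∧-linearˡ a v w η (false ∷ s) = ∧-linearˡ a (v ∘ suc) (w ∘ suc) (η ∘ (false ∷_)) s
  ∧-linearˡ a v w η (true ∷ s) = begin
    (a * v zero + w zero) * η (false ∷ s) - ((λ i → a * v (suc i) + w (suc i)) ∧ η ∘ (true ∷_)) s
      ≈⟨ +-cong (trans (distribʳ _ _ _) (+-congʳ (*-assoc _ _ _)))
                (-‿cong (∧-linearˡ a (v ∘ suc) (w ∘ suc) (η ∘ (true ∷_)) s)) ⟩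
    (a * (v zero * η (false ∷ s)) + w zero * η (false ∷ s)) -
      (a * (v ∘ suc ∧ η ∘ (true ∷_)) s + (w ∘ suc ∧ η ∘ (true ∷_)) s)
      ≈⟨ a[x-y]+[z-w] a _ _ _ _ ⟩
    a * (v ∧ η) (true ∷ s) + (w ∧ η) (true ∷ s) ∎

  -- The combination a η - θ is the shape of the `true` coordinates of a product, so this expands
  -- the inner factor of v ∧ w ∧ η.
  ∧-linearʳ : ∀ (v : Fin n → Carrier) a (η θ : Form n) s →
              (v ∧ (λ s → a * η s - θ s)) s ≈ a * (v ∧ η) s - (v ∧ θ) s
  ∧-linearʳ v a η θ [] = sym (trans (x-0≈x refl) (zeroʳ a))
  ∧-linearʳ v a η θ (false ∷ s) = ∧-linearʳ (v ∘ suc) a (η ∘ (false ∷_)) (θ ∘ (false ∷_)) s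
  ∧-linearʳ v a η θ (true ∷ s) = begin
    v zero * (a * η (false ∷ s) - θ (false ∷ s)) - (v ∘ suc ∧ (λ s → a * η (true ∷ s) - θ (true ∷ s))) s
      ≈⟨ +-cong (trans (distribˡ _ _ _) (+-cong
             (S.solve 3 (λ x a y → (x S.:* (a S.:* y)) S.:= (a S.:* (x S.:* y))) refl _ _ _)
             (sym (-‿distribʳ-* _ _))))
                (-‿cong (∧-linearʳ (v ∘ suc) a (η ∘ (true ∷_)) (θ ∘ (true ∷_)) s)) ⟩
    (a * (v zero * η (false ∷ s)) - v zero * θ (false ∷ s)) -
      (a * (v ∘ suc ∧ η ∘ (true ∷_)) s - (v ∘ suc ∧ θ ∘ (true ∷_)) s)
      ≈⟨ a[x-y]+[z-w] a _ _ _ _ ⟩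
    a * (v ∧ η) (true ∷ s) + (- (v zero * θ (false ∷ s)) - - (v ∘ suc ∧ θ ∘ (true ∷_)) s)
      ≈⟨ +-congˡ (-‿+-comm _ _) ⟩
    a * (v ∧ η) (true ∷ s) - (v ∧ θ) (true ∷ s) ∎

  -- In the coordinates containing e₀ the two terms v₀ (v′ ∧ η₀) cancel and v′ ∧ v′ ∧ η₁ is left for
  -- the induction. Anticommutativity would only give twice the square, and 2 may be a zero divisor.
  ∧-square : ∀ (v : Fin n → Carrier) η s → (v ∧ v ∧ η) s ≈ 0#
  ∧-square v η [] = refl
  ∧-square v η (false ∷ s) = ∧-square (v ∘ suc) (η ∘ (false ∷_)) s
  ∧-square v η (true ∷ s) = begin
    v zero * (v ∘ suc ∧ η ∘ (false ∷_)) s - (v ∘ suc ∧ (v ∧ η) ∘ (true ∷_)) s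
      ≈⟨ +-congˡ (-‿cong (trans (∧-linearʳ (v ∘ suc) (v zero) (η ∘ (false ∷_)) (v ∘ suc ∧ η ∘ (true ∷_)) s)
           (x-0≈x (∧-square (v ∘ suc) (η ∘ (true ∷_)) s)))) ⟩
    v zero * (v ∘ suc ∧ η ∘ (false ∷_)) s - v zero * (v ∘ suc ∧ η ∘ (false ∷_)) s
      ≈⟨ -‿inverseʳ _ ⟩
    0# ∎

  -- The coordinates containing e₀ are x - y + z. Exchanging v and w exchanges x and y, and turns z
  -- into its negative by induction.
  ∧-anticomm : ∀ (v w : Fin n → Carrier) η s → (v ∧ w ∧ η) s ≈ - (w ∧ v ∧ η) s
  ∧-anticomm v w η [] = sym -0#≈0#
  ∧-anticomm v w η (false ∷ s) = ∧-anticomm (v ∘ suc) (w ∘ suc) (η ∘ (false ∷_)) s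
  ∧-anticomm {n = suc n} v w η (true ∷ s) = begin
    x - (v ∘ suc ∧ (w ∧ η) ∘ (true ∷_)) s
      ≈⟨ +-congˡ (-‿cong (∧-linearʳ (v ∘ suc) (w zero) (η ∘ (false ∷_)) (w ∘ suc ∧ η ∘ (true ∷_)) s)) ⟩
    x - (y - z)
      ≈⟨ +-congˡ (⁻¹-anti-homo‿- y z) ⟩
    x + (z - y)
      ≈⟨ +-congˡ (+-congʳ (∧-anticomm (v ∘ suc) (w ∘ suc) (η ∘ (true ∷_)) s)) ⟩
    x + (- z′ - y)
      ≈⟨ +-assoc _ _ _ ⟨
    x - z′ - y
      ≈⟨ ⁻¹-anti-homo‿- y (x - z′) ⟨
    - (y - (x - z′))
      ≈⟨ -‿cong (+-congˡ (-‿cong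
           (∧-linearʳ (w ∘ suc) (v zero) (η ∘ (false ∷_)) (v ∘ suc ∧ η ∘ (true ∷_)) s))) ⟨
    - (y - (w ∘ suc ∧ (v ∧ η) ∘ (true ∷_)) s) ∎
    where
    x y z z′ : Carrier
    x  = v zero * (w ∘ suc ∧ η ∘ (false ∷_)) s
    y  = w zero * (v ∘ suc ∧ η ∘ (false ∷_)) s
    z  = (v ∘ suc ∧ w ∘ suc ∧ η ∘ (true ∷_)) s
    z′ = (w ∘ suc ∧ v ∘ suc ∧ η ∘ (true ∷_)) s

  ∧-∧-zero : ∀ (v w : Fin n → Carrier) {η} → (∀ s → (v ∧ η) s ≈ 0#) → ∀ s → (v ∧ w ∧ η) s ≈ 0#
  ∧-∧-zero v w {η} v∧η≈0 s = begin
    (v ∧ w ∧ η) s    ≈⟨ ∧-anticomm v w η s ⟩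
    - (w ∧ v ∧ η) s  ≈⟨ -‿cong (∧-zeroʳ w v∧η≈0 s) ⟩
    - 0#             ≈⟨ -0#≈0# ⟩
    0#               ∎

  ∧-⋀-zero : ∀ (v : Fin n → Carrier) (A : Matrix k n) {η} →
             (∀ s → (v ∧ η) s ≈ 0#) → ∀ s → (v ∧ ⋀ A η) s ≈ 0#
  ∧-⋀-zero {k = zero}  v A v∧η≈0 = v∧η≈0
  ∧-⋀-zero {k = suc k} v A v∧η≈0 = ∧-∧-zero v (A zero) (∧-⋀-zero v (A ∘ suc) v∧η≈0)

  row-∧-⋀ : ∀ (A : Matrix k n) η i s → (A i ∧ ⋀ A η) s ≈ 0#
  row-∧-⋀ A η zero    = ∧-square (A zero) (⋀ (A ∘ suc) η)
  row-∧-⋀ A η (suc i) = ∧-∧-zero (A (suc i)) (A zero) (row-∧-⋀ (A ∘ suc) η i)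

  -- Invariance under row operations. Asking that each `r i` annihilate η covers rows that are
  -- factors of η at any position; in `det-schur` they come after the remaining top rows.
  ∧-add-combination : ∀ (w : Fin n → Carrier) (a : Fin k → Carrier) (r : Matrix k n) {η} →
                      (∀ i s → (r i ∧ η) s ≈ 0#) → ∀ s →
                      ((λ j → w j + sum (λ i → a i * r i j)) ∧ η) s ≈ (w ∧ η) s
  ∧-add-combination {k = zero}  w a r r∧η≈0 s = ∧-cong (λ j → +-identityʳ (w j)) (λ _ → refl) s
  ∧-add-combination {k = suc k} w a r {η} r∧η≈0 s = begin
    ((λ j → w j + (a zero * r zero j + sum (λ i → a (suc i) * r (suc i) j))) ∧ η) s
      ≈⟨ ∧-cong (λ j → S.solve 3 (λ x y z → (x S.:+ (y S.:+ z)) S.:= (y S.:+ (x S.:+ z))) refl _ _ _)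
           (λ _ → refl) s ⟩
    ((λ j → a zero * r zero j + (w j + sum (λ i → a (suc i) * r (suc i) j))) ∧ η) s
      ≈⟨ ∧-linearˡ (a zero) (r zero) (λ j → w j + sum (λ i → a (suc i) * r (suc i) j)) η s ⟩
    a zero * (r zero ∧ η) s + ((λ j → w j + sum (λ i → a (suc i) * r (suc i) j)) ∧ η) s
      ≈⟨ +-cong (trans (*-congˡ (r∧η≈0 zero s)) (zeroʳ _))
           (∧-add-combination w (a ∘ suc) (r ∘ suc) (r∧η≈0 ∘ suc) s) ⟩
    0# + (w ∧ η) s
      ≈⟨ +-identityˡ _ ⟩
    (w ∧ η) s ∎

  -- Discarding the basis vectors that involve e_j is the algebra map induced by the projection
  -- deleting coordinate j. Minors arise in this way.
  ∧-remove : ∀ (v : Fin (suc n) → Carrier) η j s →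
             (v ∧ η) (insertAt s j false) ≈ (v ∘ punchIn j ∧ (λ s → η (insertAt s j false))) s
  ∧-remove v η zero    s           = refl
  ∧-remove v η (suc j) (false ∷ s) = ∧-remove (v ∘ suc) (η ∘ (false ∷_)) j s
  ∧-remove v η (suc j) (true ∷ s)  = +-congˡ (-‿cong (∧-remove (v ∘ suc) (η ∘ (true ∷_)) j s))

  ⋀-remove : ∀ (A : Matrix k (suc n)) η j s →
             ⋀ A η (insertAt s j false) ≈ ⋀ (λ i → A i ∘ punchIn j) (λ s → η (insertAt s j false)) s
  ⋀-remove {zero}  A η j s = refl
  ⋀-remove {suc k} A η j s = trans (∧-remove (A zero) (⋀ (A ∘ suc) η) j s)
    (∧-congˡ (⋀-remove (A ∘ suc) η j) s)

  ∧-⊤ : ∀ (v : Fin (suc n) → Carrier) η →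
        (v ∧ η) ⊤ ≈ sum (λ j → (- 1#) ^ toℕ j * v j * η (insertAt ⊤ j false))
  ∧-⊤ {zero}  v η = begin
    v zero * η (false ∷ []) - 0#              ≈⟨ x-0≈x refl ⟩
    v zero * η (false ∷ [])                   ≈⟨ *-congʳ (*-identityˡ _) ⟨
    1# * v zero * η (false ∷ [])              ≈⟨ +-identityʳ _ ⟨
    1# * v zero * η (false ∷ []) + 0#         ∎
  ∧-⊤ {suc n} v η = +-cong (*-congʳ (sym (*-identityˡ _))) (begin
    - (v ∘ suc ∧ η ∘ (true ∷_)) ⊤
      ≈⟨ -‿cong (∧-⊤ (v ∘ suc) (η ∘ (true ∷_))) ⟩
    - sum term
      ≈⟨ -1*x≈-x _ ⟨
    - 1# * sum term
      ≈⟨ *-distribˡ-sum (- 1#) term ⟩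
    sum (λ j → - 1# * term j)
      ≈⟨ sum-cong-≋ {suc n} (λ j → trans (sym (*-assoc (- 1#) _ (coord j)))
           (*-congʳ {coord j} (sym (*-assoc (- 1#) ((- 1#) ^ toℕ j) (v (suc j)))))) ⟩
    sum (λ j → (- 1#) ^ suc (toℕ j) * v (suc j) * η (true ∷ insertAt ⊤ j false)) ∎)
    where
    coord term : Fin (suc n) → Carrier
    coord j = η (true ∷ insertAt ⊤ j false)
    term j  = (- 1#) ^ toℕ j * v (suc j) * coord j

  insertAt-⊥ : (j : Fin (suc n)) → insertAt ⊥ j false ≡ ⊥ {suc n}
  insertAt-⊥         zero    = ≡.refl
  insertAt-⊥ {suc n} (suc j) = ≡.cong (false ∷_) (insertAt-⊥ j)

  -- The n rows already use up the top degree, so only the degree zero coordinate of η contributes.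
  -- A general η is kept because `det-schur` puts the product of the bottom rows in its place.
  ⋀-⊤ : ∀ (A : Matrix n n) η → ⋀ A η ⊤ ≈ det A * η ⊥
  ⋀-⊤ {zero}  A η = sym (*-identityˡ _)
  ⋀-⊤ {suc n} A η = begin
    (A zero ∧ ⋀ (A ∘ suc) η) ⊤
      ≈⟨ ∧-⊤ (A zero) (⋀ (A ∘ suc) η) ⟩
    sum (λ j → (- 1#) ^ toℕ j * A zero j * ⋀ (A ∘ suc) η (insertAt ⊤ j false))
      ≈⟨ sum-cong-≋ {suc n} (λ j → trans (*-congˡ {sign*entry j} (minor j))
           (sym (*-assoc (sign*entry j) (det (λ i k → A (suc i) (punchIn j k))) (η ⊥)))) ⟩
    sum (λ j → sign*entry j * det (λ i k → A (suc i) (punchIn j k)) * η ⊥)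
      ≈⟨ *-distribʳ-sum (η ⊥) (λ j → sign*entry j * det (λ i k → A (suc i) (punchIn j k))) ⟨
    det A * η ⊥ ∎
    where
    sign*entry : Fin (suc n) → Carrier
    sign*entry j = (- 1#) ^ toℕ j * A zero j

    minor : ∀ j → ⋀ (A ∘ suc) η (insertAt ⊤ j false) ≈ det (λ i k → A (suc i) (punchIn j k)) * η ⊥
    minor j = begin
      ⋀ (A ∘ suc) η (insertAt ⊤ j false)
        ≈⟨ ⋀-remove (A ∘ suc) η j ⊤ ⟩
      ⋀ (λ i → A (suc i) ∘ punchIn j) (λ s → η (insertAt s j false)) ⊤
        ≈⟨ ⋀-⊤ (λ i → A (suc i) ∘ punchIn j) (λ s → η (insertAt s j false)) ⟩
      det (λ i k → A (suc i) (punchIn j k)) * η (insertAt ⊥ j false)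
        ≈⟨ *-congˡ (reflexive (≡.cong η (insertAt-⊥ j))) ⟩
      det (λ i k → A (suc i) (punchIn j k)) * η ⊥ ∎

  unit-⊥ : ∀ n → unit (⊥ {n}) ≈ 1#
  unit-⊥ zero    = refl
  unit-⊥ (suc n) = unit-⊥ n

  det≈⋀ : (A : Matrix n n) → det A ≈ ⋀ A unit ⊤
  det≈⋀ {n} A = sym (trans (⋀-⊤ A unit) (trans (*-congˡ (unit-⊥ n)) (*-identityʳ _)))

  det-cong : {A B : Matrix n n} → A ≈ᴹ B → det A ≈ det B
  det-cong {A = A} {B} A≈B = trans (det≈⋀ A) (trans (⋀-cong A≈B (λ _ → refl) ⊤) (sym (det≈⋀ B)))

  det-* : ∀ a (A : Matrix n n) → det (λ i j → a * A i j) ≈ a ^ n * det A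
  det-* {zero}  a A = sym (*-identityʳ 1#)
  det-* {suc n} a A = begin
    sum (λ j → (- 1#) ^ toℕ j * (a * A zero j) * det (λ i k → a * A (suc i) (punchIn j k)))
      ≈⟨ sum-cong-≋ {suc n} (λ j → trans
           (*-congˡ {(- 1#) ^ toℕ j * (a * A zero j)} (det-* a (λ i k → A (suc i) (punchIn j k))))
           (S.solve 5 (λ s a x p d → (s S.:* (a S.:* x) S.:* (p S.:* d)) S.:=
                                     ((a S.:* p) S.:* (s S.:* x S.:* d)))
             refl ((- 1#) ^ toℕ j) a (A zero j) (a ^ n) (minor j))) ⟩
    sum (λ j → a ^ suc n * ((- 1#) ^ toℕ j * A zero j * minor j))
      ≈⟨ *-distribˡ-sum (a ^ suc n) (λ j → (- 1#) ^ toℕ j * A zero j * minor j) ⟨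
    a ^ suc n * det A ∎
    where
    minor : Fin (suc n) → Carrier
    minor j = det (λ i k → A (suc i) (punchIn j k))

  -- Schur complements of block matrices

  topLeft : ∀ m → Matrix (m ℕ.+ n) (m ℕ.+ n) → Matrix m m
  topLeft {n = n} m M i j = M (i ↑ˡ n) (j ↑ˡ n)

  topRight : ∀ m → Matrix (m ℕ.+ n) (m ℕ.+ n) → Matrix m n
  topRight {n = n} m M i j = M (i ↑ˡ n) (m ↑ʳ j)

  bottomLeft : ∀ m → Matrix (m ℕ.+ n) (m ℕ.+ n) → Matrix n m
  bottomLeft {n = n} m M i j = M (m ↑ʳ i) (j ↑ˡ n)

  bottomRight : ∀ m → Matrix (m ℕ.+ n) (m ℕ.+ n) → Matrix n n
  bottomRight {n = n} m M i j = M (m ↑ʳ i) (m ↑ʳ j)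

  ⋀-split : ∀ m (A : Matrix (m ℕ.+ k) n) η s →
            ⋀ A η s ≈ ⋀ (λ i → A (i ↑ˡ k)) (⋀ (λ i → A (m ↑ʳ i)) η) s
  ⋀-split zero    A η s = refl
  ⋀-split (suc m) A η s = ∧-congˡ (⋀-split m (A ∘ suc) η) s

  -- A vector supported on the first block cannot supply an index of t, so t is merely a parameter
  -- of a form in the first m variables.
  ∧-++ : ∀ (v : Fin (m ℕ.+ n) → Carrier) η (t : Subset n) → (∀ j → v (m ↑ʳ j) ≈ 0#) →
         ∀ s → (v ∧ η) (s ++ t) ≈ (v ∘ (_↑ˡ n) ∧ (λ s → η (s ++ t))) s
  ∧-++ v η t v≈0 []          = ∧-zeroˡ η v≈0 t
  ∧-++ v η t v≈0 (false ∷ s) = ∧-++ (v ∘ suc) (η ∘ (false ∷_)) t v≈0 s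
  ∧-++ v η t v≈0 (true ∷ s)  = +-congˡ (-‿cong (∧-++ (v ∘ suc) (η ∘ (true ∷_)) t v≈0 s))

  ⋀-++ : ∀ (A : Matrix k (m ℕ.+ n)) η (t : Subset n) → (∀ i j → A i (m ↑ʳ j) ≈ 0#) →
         ∀ s → ⋀ A η (s ++ t) ≈ ⋀ (λ i j → A i (j ↑ˡ n)) (λ s → η (s ++ t)) s
  ⋀-++ {zero}  A η t A≈0 s = refl
  ⋀-++ {suc k} A η t A≈0 s = trans (∧-++ (A zero) (⋀ (A ∘ suc) η) t (A≈0 zero) s)
    (∧-congˡ (⋀-++ (A ∘ suc) η t (A≈0 ∘ suc)) s)

  -- This is `∧-remove` for the first m coordinates at once: without indices from the first block,
  -- only the second block of v is visible.
  ∧-⊥-++ : ∀ m (v : Fin (m ℕ.+ n) → Carrier) η t →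
           (v ∧ η) (⊥ {m} ++ t) ≈ (v ∘ (m ↑ʳ_) ∧ (λ t → η (⊥ {m} ++ t))) t
  ∧-⊥-++ zero    v η t = refl
  ∧-⊥-++ (suc m) v η t = ∧-⊥-++ m (v ∘ suc) (η ∘ (false ∷_)) t

  ⋀-⊥-++ : ∀ m (A : Matrix k (m ℕ.+ n)) η t →
           ⋀ A η (⊥ {m} ++ t) ≈ ⋀ (λ i j → A i (m ↑ʳ j)) (λ t → η (⊥ {m} ++ t)) t
  ⋀-⊥-++ {zero}  m A η t = refl
  ⋀-⊥-++ {suc k} m A η t = trans (∧-⊥-++ m (A zero) (⋀ (A ∘ suc) η) t)
    (∧-congˡ (⋀-⊥-++ m (A ∘ suc) η) t)

  unit-⊥-++ : ∀ m (t : Subset n) → unit (⊥ {m} ++ t) ≈ unit t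
  unit-⊥-++ zero    t = refl
  unit-⊥-++ (suc m) t = unit-⊥-++ m t

  ⊤-++ : ∀ m n → ⊤ {m ℕ.+ n} ≡ ⊤ {m} ++ ⊤ {n}
  ⊤-++ zero    n = ≡.refl
  ⊤-++ (suc m) n = ≡.cong (true ∷_) (⊤-++ m n)

  -- `E` is the quotient of the top right block by the bottom right one, and subtracting E times the
  -- bottom rows clears the top right. Giving it as a solution of an equation also covers singular
  -- bottom right blocks, such as the case E = 0 in `det-I⊗`.
  det-schur : (M : Matrix (m ℕ.+ n) (m ℕ.+ n)) (E : Matrix m n) →
              topRight m M ≈ᴹ E *ᴹ bottomRight m M →
              det M ≈ det (λ i j → topLeft m M i j - (E *ᴹ bottomLeft m M) i j) * det (bottomRight m M)
  det-schur {m} {n} M E TR≈E*BR = begin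
    det M
      ≈⟨ det≈⋀ M ⟩
    ⋀ M unit ⊤
      ≈⟨ ⋀-split m M unit ⊤ ⟩
    ⋀ (λ i → M (i ↑ˡ n)) ω ⊤
      ≈⟨ clear-rows (λ i → M (i ↑ˡ n)) E ⊤ ⟩
    ⋀ top ω ⊤
      ≈⟨ reflexive (≡.cong (⋀ top ω) (⊤-++ m n)) ⟩
    ⋀ top ω (⊤ {m} ++ ⊤ {n})
      -- The cleared top rows live on the first m columns and are all spent in filling them. What
      -- `⋀-⊤` leaves is the coordinate of the bottom rows at the last n columns.
      ≈⟨ ⋀-++ top ω ⊤ (λ i j → trans (+-congʳ (TR≈E*BR i j)) (-‿inverseʳ _)) ⊤ ⟩
    ⋀ S (λ s → ω (s ++ ⊤ {n})) ⊤
      ≈⟨ ⋀-⊤ S (λ s → ω (s ++ ⊤ {n})) ⟩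
    det S * ω (⊥ {m} ++ ⊤ {n})
      ≈⟨ *-congˡ (⋀-⊥-++ m bottom unit ⊤) ⟩
    det S * ⋀ (bottomRight m M) (λ t → unit (⊥ {m} ++ t)) ⊤
      ≈⟨ *-congˡ (⋀-cong {A = bottomRight m M} (λ _ _ → refl) (unit-⊥-++ m) ⊤) ⟩
    det S * ⋀ (bottomRight m M) unit ⊤
      ≈⟨ *-congˡ (det≈⋀ (bottomRight m M)) ⟨
    det S * det (bottomRight m M) ∎
    where
    bottom : Matrix n (m ℕ.+ n)
    bottom i = M (m ↑ʳ i)

    ω : Form (m ℕ.+ n)
    ω = ⋀ bottom unit

    reduced : (Fin (m ℕ.+ n) → Carrier) → (Fin n → Carrier) → Fin (m ℕ.+ n) → Carrier
    reduced v a j = v j - sum (λ l → a l * bottom l j)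

    top : Matrix m (m ℕ.+ n)
    top i = reduced (M (i ↑ˡ n)) (E i)

    S : Matrix m m
    S i j = topLeft m M i j - (E *ᴹ bottomLeft m M) i j

    clear-rows : ∀ {k} (A : Matrix k (m ℕ.+ n)) (E : Matrix k n) s →
                 ⋀ A ω s ≈ ⋀ (λ i → reduced (A i) (E i)) ω s
    clear-rows {zero}  A E s = refl
    clear-rows {suc k} A E s = begin
      (A zero ∧ ⋀ (A ∘ suc) ω) s
        ≈⟨ ∧-cong (λ j → restore (A zero j) (sum (λ l → E zero l * bottom l j))) (λ _ → refl) s ⟩
      ((λ j → reduced (A zero) (E zero) j + sum (λ l → E zero l * bottom l j)) ∧ ⋀ (A ∘ suc) ω) s
        -- Each bottom row annihilates ω, hence also the product of ω with the top rows not yet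
        -- treated.
        ≈⟨ ∧-add-combination (reduced (A zero) (E zero)) (E zero) bottom
             (λ l → ∧-⋀-zero (bottom l) (A ∘ suc) (row-∧-⋀ bottom unit l)) s ⟩
      (reduced (A zero) (E zero) ∧ ⋀ (A ∘ suc) ω) s
        ≈⟨ ∧-congˡ (clear-rows (A ∘ suc) (E ∘ suc)) s ⟩
      ⋀ (λ i → reduced (A i) (E i)) ω s ∎
      where
      restore : ∀ x y → x ≈ (x - y) + y
      restore x y = sym (//-rightDividesˡ y x)

  -- After exchanging v with the next row w, a multiple of v may be added to w because v ∧ v = 0,
  -- and v stands directly before the other rows, ready for the induction. Exchanging back restores
  -- the sign.
  ∧-⋀-shear : ∀ (v : Fin n → Carrier) (a : Fin k → Carrier) (A : Matrix k n) η s →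
              (v ∧ ⋀ A η) s ≈ (v ∧ ⋀ (λ i j → a i * v j + A i j) η) s
  ∧-⋀-shear {k = zero}  v a A η s = refl
  ∧-⋀-shear {k = suc k} v a A η s = begin
    (v ∧ w ∧ ω) s        ≈⟨ ∧-anticomm v w ω s ⟩
    - (w ∧ v ∧ ω) s      ≈⟨ -‿cong (+-identityˡ _) ⟨
    - (0# + (w ∧ v ∧ ω) s)
      ≈⟨ -‿cong (+-congʳ (trans (*-congˡ (∧-square v ω s)) (zeroʳ (a zero)))) ⟨
    - (a zero * (v ∧ v ∧ ω) s + (w ∧ v ∧ ω) s)
      ≈⟨ -‿cong (∧-linearˡ (a zero) v w (v ∧ ω) s) ⟨
    - (w′ ∧ v ∧ ω) s
      ≈⟨ -‿cong (∧-congˡ {v = w′} (∧-⋀-shear v (a ∘ suc) (A ∘ suc) η) s) ⟩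
    - (w′ ∧ v ∧ ω′) s    ≈⟨ ∧-anticomm v w′ ω′ s ⟨
    (v ∧ w′ ∧ ω′) s      ∎
    where
    w w′ : Fin _ → Carrier
    w = A zero
    w′ j = a zero * v j + w j
    ω ω′ : Form _
    ω  = ⋀ (A ∘ suc) η
    ω′ = ⋀ (λ i j → a (suc i) * v j + A (suc i) j) η

  ⋀-first-column-zero : ∀ (A : Matrix k (suc n)) → (∀ i → A i zero ≈ 0#) →
                        ∀ s → ⋀ A unit (true ∷ s) ≈ 0#
  ⋀-first-column-zero {zero}  A A≈0 s = refl
  ⋀-first-column-zero {suc k} A A≈0 s = trans
    (x-0≈x (∧-zeroʳ (A zero ∘ suc) (⋀-first-column-zero (A ∘ suc) (A≈0 ∘ suc)) s))
    (trans (*-congʳ (A≈0 zero)) (zeroˡ _))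

  ⋀-false : ∀ (A : Matrix k (suc n)) η s →
            ⋀ A η (false ∷ s) ≈ ⋀ (λ i → A i ∘ suc) (η ∘ (false ∷_)) s
  ⋀-false A η s = ⋀-remove A η zero s

  -- A pivot of 1 clears the rest of the first column without division; e₀ can then come from the
  -- first row only.
  det-pivot : (A : Matrix (suc n) (suc n)) → A zero zero ≈ 1# →
              det A ≈ det (λ i j → A (suc i) (suc j) - A (suc i) zero * A zero (suc j))
  det-pivot {n} A A₀₀≈1 = begin
    det A
      ≈⟨ det≈⋀ A ⟩
    (A zero ∧ ⋀ (A ∘ suc) unit) ⊤
      ≈⟨ ∧-⋀-shear (A zero) (λ i → - A (suc i) zero) (A ∘ suc) unit ⊤ ⟩
    (A zero ∧ ⋀ B unit) ⊤
      ≈⟨ x-0≈x (∧-zeroʳ (A zero ∘ suc) (⋀-first-column-zero B B₀≈0) ⊤) ⟩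
    A zero zero * ⋀ B unit (false ∷ ⊤)
      ≈⟨ trans (*-congʳ A₀₀≈1) (*-identityˡ _) ⟩
    ⋀ B unit (false ∷ ⊤)
      ≈⟨ ⋀-false B unit ⊤ ⟩
    ⋀ (λ i → B i ∘ suc) unit ⊤
      ≈⟨ det≈⋀ (λ i → B i ∘ suc) ⟨
    det (λ i → B i ∘ suc)
      ≈⟨ det-cong {n} (λ i j → trans (+-comm _ (A (suc i) (suc j)))
           (+-congˡ (sym (-‿distribˡ-* (A (suc i) zero) (A zero (suc j)))))) ⟩
    det (λ i j → A (suc i) (suc j) - A (suc i) zero * A zero (suc j)) ∎
    where
    B : Matrix n (suc n)
    B i j = - A (suc i) zero * A zero j + A (suc i) j

    B₀≈0 : ∀ i → B i zero ≈ 0#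
    B₀≈0 i = trans (+-congʳ (trans (*-congˡ A₀₀≈1) (*-identityʳ _))) (-‿inverseˡ _)

  -- The Schur complement at the corner opposite to that of `det-schur`. Pivoting once leaves an
  -- identity block in `M′`, so it can be repeated.
  det-block-pivot : ∀ m (M : Matrix (m ℕ.+ n) (m ℕ.+ n)) → topLeft m M ≈ᴹ Iᴹ →
                    det M ≈ det (λ i j → bottomRight m M i j - (bottomLeft m M *ᴹ topRight m M) i j)
  det-block-pivot zero    M TL≈I = det-cong {A = M} (λ i j → sym (x-0≈x refl))
  det-block-pivot {n} (suc m) M TL≈I = begin
    det M
      ≈⟨ det-pivot M (TL≈I zero zero) ⟩
    det M′
      ≈⟨ det-block-pivot m M′ (λ i j → trans (x-0≈x (trans (*-congʳ (TL≈I (suc i) zero)) (zeroˡ _)))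
           (TL≈I (suc i) (suc j))) ⟩
    det (λ i j → bottomRight m M′ i j - (bottomLeft m M′ *ᴹ topRight m M′) i j)
      ≈⟨ det-cong {n} (λ i j → begin
           bottomRight m M′ i j - (bottomLeft m M′ *ᴹ topRight m M′) i j
             -- The identity block vanishes off its diagonal, so the pivot does not alter the
             -- remaining entries of the bottom left and top right blocks. The bottom right block
             -- gains exactly the first term of the product.
             ≈⟨ +-congˡ (-‿cong (sum-cong-≋ (λ l → *-cong
                  (x-0≈x (trans (*-congˡ (TL≈I zero (suc l))) (zeroʳ _)))
                  (x-0≈x (trans (*-congʳ (TL≈I (suc l) zero)) (zeroˡ _)))))) ⟩
           bottomRight (suc m) M i j - bottomLeft (suc m) M i zero * topRight (suc m) M zero j -
             sum (λ l → bottomLeft (suc m) M i (suc l) * topRight (suc m) M (suc l) j)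
             ≈⟨ trans (+-assoc _ _ _) (+-congˡ (-‿+-comm _ _)) ⟩
           bottomRight (suc m) M i j - (bottomLeft (suc m) M *ᴹ topRight (suc m) M) i j ∎) ⟩
    det (λ i j → bottomRight (suc m) M i j - (bottomLeft (suc m) M *ᴹ topRight (suc m) M) i j) ∎
    where
    M′ : Matrix (m ℕ.+ n) (m ℕ.+ n)
    M′ i j = M (suc i) (suc j) - M (suc i) zero * M zero (suc j)

-- Sylvester's identity and determinants of Kronecker products

module BlockDeterminants (R : CommutativeRing c ℓ) where

  open CommutativeRing R hiding (zero)
  open Matrices R
  open Determinants R
  open SemiringSum semiring
  open Exponentiation semiring using (_^_; ^-homo-*; ^-congʳ)
  open RingProperties ring
  open Multiples semiring using (×-assoc-*; ×-congʳ) renaming (_×_ to _×′_)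
  open SetoidReasoning setoid
  private module S = SemiringSolver commutativeSemiring

  det-Iᴹ : ∀ n → det (Iᴹ {n}) ≈ 1#
  det-Iᴹ zero    = refl
  det-Iᴹ (suc n) = begin
    det (Iᴹ {suc n})                        ≈⟨ det-pivot (Iᴹ {suc n}) refl ⟩
    det (λ i j → Iᴹ {n} i j - 0# * 0#)      ≈⟨ det-cong {n} (λ i j → x-0≈x (zeroˡ 0#)) ⟩
    det (Iᴹ {n})                            ≈⟨ det-Iᴹ n ⟩
    1#                                      ∎

  det-scalar : ∀ n a → det (λ i j → a * Iᴹ {n} i j) ≈ a ^ n
  det-scalar n a = trans (det-* {n} a Iᴹ) (trans (*-congˡ (det-Iᴹ n)) (*-identityʳ _))

  -- Both sides are c ^ n * det M for the block matrix M = [[1 , V] , [U , c]].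
  det-sylvester : ∀ (U : Matrix m n) (V : Matrix n m) {c e} → e * c ≈ 1# →
                  c ^ n * det (c ·I- (U *ᴹ V)) ≈ c ^ m * det (c ·I- (V *ᴹ U))
  det-sylvester {m} {n} U V {c} {e} ec≈1 = begin
    c ^ n * det (c ·I- (U *ᴹ V))
      ≈⟨ *-congˡ (det-cong {m} (λ i j → +-cong (bottomRight≈ i j)
           (-‿cong (sum-cong-≋ (λ l → *-cong (bottomLeft≈ i l) (topRight≈ l j)))))) ⟨
    c ^ n * det (λ i j → bottomRight n M i j - (bottomLeft n M *ᴹ topRight n M) i j)
      ≈⟨ *-congˡ (det-block-pivot n M topLeft≈) ⟨
    c ^ n * det M
      ≈⟨ *-congˡ (det-schur M E topRight≈E*bottomRight) ⟩
    c ^ n * (det T * det (bottomRight n M))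
      ≈⟨ S.solve 3 (λ x y z → (x S.:* (y S.:* z)) S.:= (z S.:* (x S.:* y))) refl
           (c ^ n) (det T) (det (bottomRight n M)) ⟩
    det (bottomRight n M) * (c ^ n * det T)
      ≈⟨ *-cong (trans (det-cong {m} bottomRight≈) (det-scalar m c)) (sym (det-* {n} c T)) ⟩
    c ^ m * det (λ i j → c * T i j)
      ≈⟨ *-congˡ (det-cong {n} scaled) ⟩
    c ^ m * det (c ·I- (V *ᴹ U)) ∎
    where
    M : Matrix (n ℕ.+ m) (n ℕ.+ m)
    M u v = [ (λ i → [ Iᴹ i , V i ]′ (splitAt n v))
            , (λ k → [ U k , (λ l → c * Iᴹ k l) ]′ (splitAt n v)) ]′ (splitAt n u)

    -- This is V c⁻¹, the bottom right block of M being c. The Schur complement `T` = 1 - V c⁻¹ U is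
    -- freed of the inverse by the factor `c ^ n`, one c for each row.
    E : Matrix n m
    E i l = e * V i l

    T : Matrix n n
    T i j = topLeft n M i j - (E *ᴹ bottomLeft n M) i j

    topLeft≈ : topLeft n M ≈ᴹ Iᴹ
    topLeft≈ i j rewrite splitAt-↑ˡ n i m | splitAt-↑ˡ n j m = refl

    topRight≈ : topRight n M ≈ᴹ V
    topRight≈ i j rewrite splitAt-↑ˡ n i m | splitAt-↑ʳ n m j = refl

    bottomLeft≈ : bottomLeft n M ≈ᴹ U
    bottomLeft≈ i j rewrite splitAt-↑ʳ n m i | splitAt-↑ˡ n j m = refl

    bottomRight≈ : bottomRight n M ≈ᴹ (λ i j → c * Iᴹ i j)
    bottomRight≈ i j rewrite splitAt-↑ʳ n m i | splitAt-↑ʳ n m j = refl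

    topRight≈E*bottomRight : topRight n M ≈ᴹ E *ᴹ bottomRight n M
    topRight≈E*bottomRight i j = begin
      topRight n M i j                      ≈⟨ topRight≈ i j ⟩
      V i j                                 ≈⟨ *ᴹ-identityʳ V i j ⟨
      sum (λ l → V i l * Iᴹ l j)
        ≈⟨ sum-cong-≋ (λ l → trans (*-congʳ (trans (sym (*-identityˡ _)) (*-congʳ (sym ec≈1))))
             (S.solve 4 (λ e c v d → (e S.:* c S.:* v S.:* d) S.:= (e S.:* v S.:* (c S.:* d)))
               refl e c (V i l) (Iᴹ l j))) ⟩
      sum (λ l → e * V i l * (c * Iᴹ l j))  ≈⟨ *ᴹ-congˡ E bottomRight≈ i j ⟨
      (E *ᴹ bottomRight n M) i j            ∎

    scaled : (λ i j → c * T i j) ≈ᴹ (c ·I- (V *ᴹ U))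
    scaled i j = trans (x[y-z]≈xy-xz c _ _) (+-cong (*-congˡ (topLeft≈ i j)) (-‿cong (begin
      c * sum (λ l → e * V i l * bottomLeft n M l j)
        ≈⟨ *-distribˡ-sum c (λ l → e * V i l * bottomLeft n M l j) ⟩
      sum (λ l → c * (e * V i l * bottomLeft n M l j))
        ≈⟨ sum-cong-≋ (λ l → trans
             (S.solve 4 (λ c e v u → (c S.:* (e S.:* v S.:* u)) S.:= (e S.:* c S.:* (v S.:* u)))
               refl c e (V i l) (bottomLeft n M l j))
             (trans (*-congʳ ec≈1) (trans (*-identityˡ _) (*-congˡ (bottomLeft≈ l j))))) ⟩
      (V *ᴹ U) i j ∎)))

  sum-↑ : ∀ m (f : Fin (m ℕ.+ n) → Carrier) →
          sum f ≈ sum (λ i → f (i ↑ˡ n)) + sum (λ j → f (m ↑ʳ j))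
  sum-↑ zero    f = sym (+-identityˡ _)
  sum-↑ (suc m) f = trans (+-congˡ (sum-↑ m (f ∘ suc))) (sym (+-assoc _ _ _))

  sum-combine : ∀ m (f : Fin (m ℕ.* n) → Carrier) →
                sum f ≈ sum (λ i → sum (λ k → f (combine {m} i k)))
  sum-combine         zero    f = refl
  sum-combine {n = n} (suc m) f = trans (sum-↑ n f) (+-congˡ (sum-combine m (f ∘ (n ↑ʳ_))))

  sum-const : ∀ n x → sum {n} (λ _ → x) ≈ fromℕ n * x
  sum-const n x = begin
    sum {n} (λ _ → x)  ≈⟨ sum-replicate n ⟩
    n ×′ x             ≈⟨ ×-congʳ n (*-identityˡ x) ⟨
    n ×′ (1# * x)      ≈⟨ ×-assoc-* n 1# x ⟨
    fromℕ n * x        ∎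

  Iᴹ-↑ˡ : ∀ n (i j : Fin m) → Iᴹ (i ↑ˡ n) (j ↑ˡ n) ≈ Iᴹ i j
  Iᴹ-↑ˡ n zero    zero    = refl
  Iᴹ-↑ˡ n zero    (suc j) = refl
  Iᴹ-↑ˡ n (suc i) zero    = refl
  Iᴹ-↑ˡ n (suc i) (suc j) = Iᴹ-↑ˡ n i j

  Iᴹ-↑ʳ : ∀ m (i j : Fin n) → Iᴹ (m ↑ʳ i) (m ↑ʳ j) ≈ Iᴹ i j
  Iᴹ-↑ʳ zero    i j = refl
  Iᴹ-↑ʳ (suc m) i j = Iᴹ-↑ʳ m i j

  Iᴹ-↑ˡ-↑ʳ : (i : Fin m) (j : Fin n) → Iᴹ (i ↑ˡ n) (m ↑ʳ j) ≈ 0#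
  Iᴹ-↑ˡ-↑ʳ zero    j = refl
  Iᴹ-↑ˡ-↑ʳ (suc i) j = Iᴹ-↑ˡ-↑ʳ i j

  Iᴹ-↑ʳ-↑ˡ : (i : Fin m) (j : Fin n) → Iᴹ (m ↑ʳ j) (i ↑ˡ n) ≈ 0#
  Iᴹ-↑ʳ-↑ˡ {m} {n} i j = trans (Iᴹ-symmetric (m ↑ʳ j) (i ↑ˡ n)) (Iᴹ-↑ˡ-↑ʳ i j)

  Iᴹ-combine : (i j : Fin m) (k l : Fin n) → Iᴹ (combine i k) (combine j l) ≈ Iᴹ i j * Iᴹ k l
  Iᴹ-combine {suc m} {n} zero zero k l = trans (Iᴹ-↑ˡ (m ℕ.* n) k l) (sym (*-identityˡ _))
  Iᴹ-combine zero (suc j) k l = trans (Iᴹ-↑ˡ-↑ʳ k (combine j l)) (sym (zeroˡ _))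
  Iᴹ-combine (suc i) zero k l = trans (Iᴹ-↑ʳ-↑ˡ l (combine i k)) (sym (zeroˡ _))
  Iᴹ-combine {n = n} (suc i) (suc j) k l =
    trans (Iᴹ-↑ʳ n (combine i k) (combine j l)) (Iᴹ-combine {n = n} i j k l)

  -- I ⊗ D is block diagonal, so `det-schur` with E = 0 splits off one copy of D and leaves a matrix
  -- of the same kind.
  det-I⊗ : ∀ m (D : Matrix n n) (M : Matrix (m ℕ.* n) (m ℕ.* n)) →
           (∀ i k j l → M (combine {m} i k) (combine {m} j l) ≈ Iᴹ i j * D k l) →
           det M ≈ det D ^ m
  det-I⊗         zero    D M M≈ = refl
  det-I⊗ {n = n} (suc m) D M M≈ = begin
    det M
      ≈⟨ det-schur {n} M (λ _ _ → 0#) (λ k v → begin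
           topRight n M k v
             ≡⟨ ≡.cong (topRight n M k) (combine-remQuot {m} n v) ⟨
           topRight n M k (combine (quotient {m} n v) (remainder {m} n v))
             ≈⟨ trans (M≈ zero k (suc (quotient {m} n v)) (remainder {m} n v)) (zeroˡ _) ⟩
           0#
             ≈⟨ sum-zero (λ u → 0# * bottomRight n M u v) (λ u → zeroˡ _) ⟨
           sum (λ u → 0# * bottomRight n M u v) ∎) ⟩
    det (λ k l → topLeft n M k l - ((λ _ _ → 0#) *ᴹ bottomLeft n M) k l) * det (bottomRight n M)
      ≈⟨ *-cong
           (det-cong {n} (λ k l → trans
             (x-0≈x (sum-zero (λ u → 0# * bottomLeft n M u l) (λ u → zeroˡ _)))
             (trans (M≈ zero k zero l) (*-identityˡ _))))
           (det-I⊗ m D (bottomRight n M) (λ i k j l → M≈ (suc i) k (suc j) l)) ⟩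
    det D * det D ^ m ∎

  ^-cancelˡ : ∀ {c e} → e * c ≈ 1# → ∀ n {x y} → c ^ n * x ≈ c ^ n * y → x ≈ y
  ^-cancelˡ ec≈1 zero    p = trans (sym (*-identityˡ _)) (trans p (*-identityˡ _))
  ^-cancelˡ {c} {e} ec≈1 (suc n) {x} {y} p = ^-cancelˡ ec≈1 n (begin
    c ^ n * x            ≈⟨ expand x ⟨
    e * (c * c ^ n * x)  ≈⟨ *-congˡ p ⟩
    e * (c * c ^ n * y)  ≈⟨ expand y ⟩
    c ^ n * y            ∎)
    where
    expand : ∀ z → e * (c * c ^ n * z) ≈ c ^ n * z
    expand z = begin
      e * (c * c ^ n * z)
        ≈⟨ S.solve 4 (λ e c p z → (e S.:* (c S.:* p S.:* z)) S.:= (e S.:* c S.:* (p S.:* z)))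
             refl e c (c ^ n) z ⟩
      e * c * (c ^ n * z)  ≈⟨ *-congʳ ec≈1 ⟩
      1# * (c ^ n * z)     ≈⟨ *-identityˡ _ ⟩
      c ^ n * z            ∎

  -- Here B ⊗ J = U V with U = I ⊗ 1 and V = B ⊗ 1ᵀ, where 1 is the all-ones column of length
  -- `suc n`. Sylvester's identity puts `c ^ m` on the left and `c ^ (m * suc n)` on the right;
  -- cancelling `c ^ m` leaves the exponent `m * n`.
  det-c-⊗J : ∀ m n {c e} → e * c ≈ 1# → (B : Matrix m m) (M : Matrix (m ℕ.* suc n) (m ℕ.* suc n)) →
             (∀ i k j l → M (combine {m} i k) (combine {m} j l) ≈
                          c * Iᴹ (combine {m} i k) (combine {m} j l) - B i j) →
             det M ≈ c ^ (m ℕ.* n) * det (c ·I- (λ i j → fromℕ (suc n) * B i j))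
  det-c-⊗J m n {c} ec≈1 B M M≈ = ^-cancelˡ ec≈1 m (begin
    c ^ m * det M
      ≈⟨ *-congˡ (det-cong {m ℕ.* suc n} M≈c-UV) ⟩
    c ^ m * det (c ·I- (U *ᴹ V))
      ≈⟨ det-sylvester U V ec≈1 ⟩
    c ^ (m ℕ.* suc n) * det (c ·I- (V *ᴹ U))
      ≈⟨ *-cong (trans (^-congʳ c (ℕₚ.*-suc m n)) (^-homo-* c m (m ℕ.* n)))
           (det-cong {m} (λ i j → +-congˡ (-‿cong (VU≈ i j)))) ⟩
    c ^ m * c ^ (m ℕ.* n) * det (c ·I- (λ i j → fromℕ (suc n) * B i j))
      ≈⟨ *-assoc _ _ _ ⟩
    c ^ m * (c ^ (m ℕ.* n) * det (c ·I- (λ i j → fromℕ (suc n) * B i j))) ∎)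
    where
    q : Fin (m ℕ.* suc n) → Fin m
    q = quotient (suc n)

    U : Matrix (m ℕ.* suc n) m
    U u j = Iᴹ (q u) j

    V : Matrix m (m ℕ.* suc n)
    V i v = B i (q v)

    M≈c-UV : M ≈ᴹ (c ·I- (U *ᴹ V))
    M≈c-UV u v = begin
      M u v
        ≡⟨ ≡.cong₂ M (combine-remQuot {m} (suc n) u) (combine-remQuot {m} (suc n) v) ⟨
      M (combine {m} (q u) _) (combine {m} (q v) _)
        ≈⟨ M≈ (q u) _ (q v) _ ⟩
      c * Iᴹ (combine {m} (q u) _) (combine {m} (q v) _) - B (q u) (q v)
        ≡⟨ ≡.cong₂ (λ u′ v′ → c * Iᴹ u′ v′ - B (q u) (q v))
             (combine-remQuot {m} (suc n) u) (combine-remQuot {m} (suc n) v) ⟩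
      c * Iᴹ u v - B (q u) (q v)
        ≈⟨ +-congˡ (-‿cong (*ᴹ-identityˡ B (q u) (q v))) ⟨
      (c ·I- (U *ᴹ V)) u v ∎

    VU≈ : V *ᴹ U ≈ᴹ (λ i j → fromℕ (suc n) * B i j)
    VU≈ i j = begin
      sum (λ u → B i (q u) * Iᴹ (q u) j)
        ≈⟨ sum-combine m (λ u → B i (q u) * Iᴹ (q u) j) ⟩
      sum (λ i′ → sum (λ (k : Fin (suc n)) → B i (q (combine {m} i′ k)) * Iᴹ (q (combine {m} i′ k)) j))
        ≈⟨ sum-cong-≋ (λ i′ → sum-cong-≋ {suc n} (λ k → reflexive
             (≡.cong (λ i″ → B i i″ * Iᴹ i″ j) (≡.cong proj₁ (remQuot-combine {m} i′ k))))) ⟩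
      sum (λ i′ → sum (λ (_ : Fin (suc n)) → B i i′ * Iᴹ i′ j))
        ≈⟨ sum-cong-≋ (λ i′ → sum-const (suc n) (B i i′ * Iᴹ i′ j)) ⟩
      sum (λ i′ → fromℕ (suc n) * (B i i′ * Iᴹ i′ j))
        ≈⟨ *-distribˡ-sum (fromℕ (suc n)) (λ i′ → B i i′ * Iᴹ i′ j) ⟨
      fromℕ (suc n) * (B *ᴹ Iᴹ) i j
        ≈⟨ *-congˡ (*ᴹ-identityʳ B i j) ⟩
      fromℕ (suc n) * B i j ∎

-- The signless Laplacian of the product of regular graphs

module SignlessLaplacians (R : CommutativeRing c ℓ) where

  open CommutativeRing R hiding (zero)
  open Matrices R
  open Determinants R
  open BlockDeterminants R
  open SemiringSum semiring
  open Exponentiation semiring using (_^_)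
  open RingProperties ring
  open SetoidReasoning setoid
  private module S = SemiringSolver commutativeSemiring

  indicator : Bool → Carrier
  indicator b = if b then 1# else 0#

  fromℕ-∣tabulate∣ : (b : Fin n → Bool) → fromℕ ∣ tabulate b ∣ ≈ sum (indicator ∘ b)
  fromℕ-∣tabulate∣ {zero}  b = refl
  fromℕ-∣tabulate∣ {suc n} b with b zero
  ... | true  = +-congˡ (fromℕ-∣tabulate∣ (b ∘ suc))
  ... | false = trans (fromℕ-∣tabulate∣ (b ∘ suc)) (sym (+-identityˡ _))

  indicator-∧ : ∀ a b → indicator (a Bool.∧ b) ≈ indicator a * indicator b
  indicator-∧ true  b = sym (*-identityˡ _)
  indicator-∧ false b = sym (zeroˡ _)

  diagonal≈ : (d : Fin n → Carrier) (i j : Fin n) → diagonal d i j ≈ d i * Iᴹ i j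
  diagonal≈ d i j with does (i ≟ j)
  ... | true  = sym (*-identityʳ _)
  ... | false = sym (zeroʳ _)

  sum-Iᴹ-row : (i : Fin n) → sum (Iᴹ i) ≈ 1#
  sum-Iᴹ-row {n} i = trans (sum-cong-≋ (λ j → sym (*-identityʳ (Iᴹ i j))))
    (*ᴹ-identityˡ {n} {1} (λ _ _ → 1#) i zero)

  -- With δ an entry of the identity, this moves the degree part of a signless Laplacian into the
  -- scalar from which the matrix is subtracted, and back.
  merge : ∀ s y δ a → s * δ - (y * δ + a) ≈ (s - y) * δ - a
  merge s y δ a = begin
    s * δ - (y * δ + a)          ≈⟨ +-congˡ (trans (sym (-‿+-comm _ _)) (+-congʳ (-‿distribˡ-* y δ))) ⟩
    s * δ + (- y * δ - a)        ≈⟨ +-assoc _ _ _ ⟨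
    s * δ + - y * δ - a          ≈⟨ +-congʳ (distribʳ δ s (- y)) ⟨
    (s - y) * δ - a              ∎

  x-[y+z]≈x-y-z : ∀ x y z → x - (y + z) ≈ x - y - z
  x-[y+z]≈x-y-z x y z = trans (+-congˡ (sym (-‿+-comm y z))) (sym (+-assoc _ _ _))

  signlessLaplacian-regular : ∀ {r} (G : Graph n) → Regular r G → ∀ i j →
    signlessLaplacian G i j ≈ fromℕ r * Iᴹ i j + adjacencyMatrix G i j
  signlessLaplacian-regular G regular i j = +-congʳ
    (trans (diagonal≈ (λ i → fromℕ (degree G i)) i j)
           (*-congʳ (reflexive (≡.cong fromℕ (regular i)))))

  sum-adjacency : ∀ {r} (G : Graph n) → Regular r G → ∀ i → sum (adjacencyMatrix G i) ≈ fromℕ r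
  sum-adjacency G regular i =
    trans (sym (fromℕ-∣tabulate∣ (adjacent G i))) (reflexive (≡.cong fromℕ (regular i)))

  combine-induction : ∀ m {s} {P : Fin (m ℕ.* n) → Set s} →
                      (∀ i k → P (combine {m} i k)) → ∀ u → P u
  combine-induction {n} m {P = P} step u = ≡.subst P (combine-remQuot {m} n u)
    (step (quotient {m} n u) (remainder {m} n u))

  module Product {n₁ n₂ r₁ r₂ : ℕ} (G₁ : Graph n₁) (G₂ : Graph n₂)
                 (regular₁ : Regular r₁ G₁) (regular₂ : Regular r₂ G₂) where

    p : ℕ
    p = n₁ ℕ.* n₂

    N₂ : Carrier
    N₂ = fromℕ n₂

    A₁ : Matrix n₁ n₁
    A₁ = adjacencyMatrix G₁

    A₂ : Matrix n₂ n₂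
    A₂ = adjacencyMatrix G₂

    a b : Fin n₁ → Fin n₂ → Fin (p ℕ.+ p)
    a i k = combine i k ↑ˡ p
    b i k = p ↑ʳ combine i k

    vertex-a : ∀ i k → productVertex {n₁} (a i k) ≡ inj₁ (i , k)
    vertex-a i k rewrite splitAt-↑ˡ p (combine i k) p = ≡.cong inj₁ (remQuot-combine i k)

    vertex-b : ∀ i k → productVertex {n₁} (b i k) ≡ inj₂ (i , k)
    vertex-b i k rewrite splitAt-↑ʳ p p (combine i k) = ≡.cong inj₂ (remQuot-combine i k)

    A : Matrix (p ℕ.+ p) (p ℕ.+ p)
    A = adjacencyMatrix (G₁ ⊛ G₂)

    adjacency-aa : ∀ i k j l → A (a i k) (a j l) ≈ A₁ i j
    adjacency-aa i k j l =
      reflexive (≡.cong₂ (λ u v → indicator (productAdjacent G₁ G₂ u v)) (vertex-a i k) (vertex-a j l))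

    adjacency-ab : ∀ i k j l → A (a i k) (b j l) ≈ Iᴹ i j
    adjacency-ab i k j l =
      reflexive (≡.cong₂ (λ u v → indicator (productAdjacent G₁ G₂ u v)) (vertex-a i k) (vertex-b j l))

    adjacency-ba : ∀ i k j l → A (b i k) (a j l) ≈ Iᴹ i j
    adjacency-ba i k j l =
      reflexive (≡.cong₂ (λ u v → indicator (productAdjacent G₁ G₂ u v)) (vertex-b i k) (vertex-a j l))

    adjacency-bb : ∀ i k j l → A (b i k) (b j l) ≈ Iᴹ i j * A₂ k l
    adjacency-bb i k j l = trans
      (reflexive (≡.cong₂ (λ u v → indicator (productAdjacent G₁ G₂ u v)) (vertex-b i k) (vertex-b j l)))
      (indicator-∧ (does (i ≟ j)) (adjacent G₂ k l))

    sum-vertices : (f : Fin (p ℕ.+ p) → Carrier) →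
                   sum f ≈ sum (λ i → sum (λ k → f (a i k))) + sum (λ i → sum (λ k → f (b i k)))
    sum-vertices f = trans (sum-↑ p f)
      (+-cong (sum-combine n₁ (f ∘ (_↑ˡ p))) (sum-combine n₁ (f ∘ (p ↑ʳ_))))

    sum-rows : ∀ (f : Fin n₁ → Carrier) →
               sum (λ i → sum {n₂} (λ _ → f i)) ≈ sum f * N₂
    sum-rows f = begin
      sum (λ i → sum {n₂} (λ _ → f i))  ≈⟨ sum-cong-≋ (λ i → trans (sum-const n₂ (f i)) (*-comm _ _)) ⟩
      sum (λ i → f i * N₂)              ≈⟨ *-distribʳ-sum N₂ f ⟨
      sum f * N₂                        ∎

    sum-Iᴹ-rows : ∀ i → sum (λ j → sum {n₂} (λ _ → Iᴹ i j)) ≈ N₂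
    sum-Iᴹ-rows i = trans (sum-rows (Iᴹ i)) (trans (*-congʳ (sum-Iᴹ-row i)) (*-identityˡ N₂))

    degree-a : ∀ i k → fromℕ (degree (G₁ ⊛ G₂) (a i k)) ≈ fromℕ r₁ * N₂ + N₂
    degree-a i k = begin
      fromℕ (degree (G₁ ⊛ G₂) (a i k))
        ≈⟨ fromℕ-∣tabulate∣ (adjacent (G₁ ⊛ G₂) (a i k)) ⟩
      sum (A (a i k))
        ≈⟨ sum-vertices (A (a i k)) ⟩
      sum (λ j → sum (λ l → A (a i k) (a j l))) + sum (λ j → sum (λ l → A (a i k) (b j l)))
        ≈⟨ +-cong (sum-cong-≋ (λ j → sum-cong-≋ (adjacency-aa i k j)))
                  (sum-cong-≋ (λ j → sum-cong-≋ (adjacency-ab i k j))) ⟩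
      sum (λ j → sum {n₂} (λ _ → A₁ i j)) + sum (λ j → sum {n₂} (λ _ → Iᴹ i j))
        ≈⟨ +-cong (trans (sum-rows (A₁ i)) (*-congʳ (sum-adjacency G₁ regular₁ i))) (sum-Iᴹ-rows i) ⟩
      fromℕ r₁ * N₂ + N₂ ∎

    degree-b : ∀ i k → fromℕ (degree (G₁ ⊛ G₂) (b i k)) ≈ N₂ + fromℕ r₂
    degree-b i k = begin
      fromℕ (degree (G₁ ⊛ G₂) (b i k))
        ≈⟨ fromℕ-∣tabulate∣ (adjacent (G₁ ⊛ G₂) (b i k)) ⟩
      sum (A (b i k))
        ≈⟨ sum-vertices (A (b i k)) ⟩
      sum (λ j → sum (λ l → A (b i k) (a j l))) + sum (λ j → sum (λ l → A (b i k) (b j l)))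
        ≈⟨ +-cong (sum-cong-≋ (λ j → sum-cong-≋ (adjacency-ba i k j)))
                  (sum-cong-≋ (λ j → sum-cong-≋ (adjacency-bb i k j))) ⟩
      sum (λ j → sum {n₂} (λ _ → Iᴹ i j)) + sum (λ j → sum (λ l → Iᴹ i j * A₂ k l))
        ≈⟨ +-cong (sum-Iᴹ-rows i) (sum-cong-≋ (λ j → sym (*-distribˡ-sum (Iᴹ i j) (A₂ k)))) ⟩
      N₂ + sum (λ j → Iᴹ i j * sum (A₂ k))
        ≈⟨ +-congˡ (*ᴹ-identityˡ {n = 1} (λ _ _ → sum (A₂ k)) i zero) ⟩
      N₂ + sum (A₂ k)
        ≈⟨ +-congˡ (sum-adjacency G₂ regular₂ k) ⟩
      N₂ + fromℕ r₂ ∎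

    module _ (t : Carrier) where

      M : Matrix (p ℕ.+ p) (p ℕ.+ p)
      M = t ·I- signlessLaplacian (G₁ ⊛ G₂)

      α : Carrier
      α = t - fromℕ r₁ * N₂ - N₂

      D : Matrix n₂ n₂
      D = (t - N₂) ·I- signlessLaplacian G₂

      M≈ : ∀ u v → M u v ≈ (t - fromℕ (degree (G₁ ⊛ G₂) u)) * Iᴹ u v - A u v
      M≈ u v = trans
        (+-congˡ (-‿cong (+-congʳ (diagonal≈ (λ u → fromℕ (degree (G₁ ⊛ G₂) u)) u v))))
        (merge t _ _ _)

      M-aa : ∀ i k j l → M (a i k) (a j l) ≈ α * Iᴹ (combine i k) (combine j l) - A₁ i j
      M-aa i k j l = trans (M≈ (a i k) (a j l)) (+-cong
        (*-cong (trans (+-congˡ (-‿cong (degree-a i k))) (x-[y+z]≈x-y-z _ _ _))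
                (Iᴹ-↑ˡ p (combine i k) (combine j l)))
        (-‿cong (adjacency-aa i k j l)))

      M-ab : ∀ i k j l → M (a i k) (b j l) ≈ - Iᴹ i j
      M-ab i k j l = trans (M≈ (a i k) (b j l)) (trans
        (+-cong (trans (*-congˡ (Iᴹ-↑ˡ-↑ʳ (combine i k) (combine j l))) (zeroʳ _))
                (-‿cong (adjacency-ab i k j l)))
        (+-identityˡ _))

      M-ba : ∀ i k j l → M (b i k) (a j l) ≈ - Iᴹ i j
      M-ba i k j l = trans (M≈ (b i k) (a j l)) (trans
        (+-cong (trans (*-congˡ (Iᴹ-↑ʳ-↑ˡ (combine j l) (combine i k))) (zeroʳ _))
                (-‿cong (adjacency-ba i k j l)))
        (+-identityˡ _))

      M-bb : ∀ i k j l → M (b i k) (b j l) ≈ Iᴹ i j * D k l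
      M-bb i k j l = begin
        M (b i k) (b j l)
          ≈⟨ M≈ (b i k) (b j l) ⟩
        (t - fromℕ (degree (G₁ ⊛ G₂) (b i k))) * Iᴹ (b i k) (b j l) - A (b i k) (b j l)
          ≈⟨ +-cong
               (*-cong (trans (+-congˡ (-‿cong (degree-b i k))) (x-[y+z]≈x-y-z _ _ _))
                       (trans (Iᴹ-↑ʳ p (combine i k) (combine j l)) (Iᴹ-combine i j k l)))
               (-‿cong (adjacency-bb i k j l)) ⟩
        (t - N₂ - fromℕ r₂) * (Iᴹ i j * Iᴹ k l) - Iᴹ i j * A₂ k l
          ≈⟨ +-congʳ (S.solve 3 (λ x y z → (x S.:* (y S.:* z)) S.:= (y S.:* (x S.:* z))) refl _ _ _) ⟩
        Iᴹ i j * ((t - N₂ - fromℕ r₂) * Iᴹ k l) - Iᴹ i j * A₂ k l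
          ≈⟨ x[y-z]≈xy-xz _ _ _ ⟨
        Iᴹ i j * ((t - N₂ - fromℕ r₂) * Iᴹ k l - A₂ k l)
          ≈⟨ *-congˡ (merge _ _ _ _) ⟨
        Iᴹ i j * ((t - N₂) * Iᴹ k l - (fromℕ r₂ * Iᴹ k l + A₂ k l))
          ≈⟨ *-congˡ (+-congˡ (-‿cong (signlessLaplacian-regular G₂ regular₂ k l))) ⟨
        Iᴹ i j * D k l ∎

      -- The coronal of Q(G₂) at t - n₂ enters through the column sums of D⁻¹,
      -- as the Schur complement of I ⊗ D contains (I ⊗ J)(I ⊗ D⁻¹)(I ⊗ J).
      module _ (N : Matrix n₂ n₂) (ND≈I : N *ᴹ D ≈ᴹ Iᴹ) where

        columnSum : Fin n₂ → Carrier
        columnSum l = sum (λ k → N k l)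

        χ : Carrier
        χ = sum columnSum

        -- The column sums form the row vector 1ᵀ D⁻¹, and 1ᵀ D⁻¹ D = 1ᵀ. This makes `E` solve the
        -- equation that `det-schur` asks for.
        columnSum-D : ∀ l → sum (λ l′ → columnSum l′ * D l′ l) ≈ 1#
        columnSum-D l = begin
          sum (λ l′ → columnSum l′ * D l′ l)
            ≈⟨ sum-cong-≋ (λ l′ → *-distribʳ-sum (D l′ l) (λ k → N k l′)) ⟩
          sum (λ l′ → sum (λ k → N k l′ * D l′ l))
            ≈⟨ ∑-comm (λ l′ k → N k l′ * D l′ l) ⟩
          sum (λ k → (N *ᴹ D) k l)
            ≈⟨ sum-cong-≋ (λ k → trans (ND≈I k l) (Iᴹ-symmetric k l)) ⟩
          sum (Iᴹ l)
            ≈⟨ sum-Iᴹ-row l ⟩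
          1# ∎

        -- The product (- I ⊗ J)(I ⊗ D⁻¹) in closed form: all rows of J D⁻¹ equal the vector of
        -- column sums, so the entry is independent of the remainder of u.
        E : Matrix p p
        E u v = - Iᴹ (quotient {n₁} n₂ u) (quotient {n₁} n₂ v) * columnSum (remainder {n₁} n₂ v)

        E-combine : ∀ i k j l → E (combine i k) (combine j l) ≈ - Iᴹ i j * columnSum l
        E-combine i k j l = reflexive (≡.cong₂
          (λ (u v : Fin n₁ × Fin n₂) → - Iᴹ (proj₁ u) (proj₁ v) * columnSum (proj₂ v))
          (remQuot-combine {n₁} i k) (remQuot-combine {n₁} j l))

        -- The columns of both lower blocks are pure tensors g ⊗ h, with h a column of D on the
        -- right and a constant vector on the left, so one computation serves both.
        E*-combine : ∀ (B : Matrix p n) (g : Fin n₁ → Carrier) (h : Fin n₂ → Carrier) i k v →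
                     (∀ j l → B (combine j l) v ≈ g j * h l) →
                     (E *ᴹ B) (combine i k) v ≈ - g i * sum (λ l → columnSum l * h l)
        E*-combine B g h i k v B≈ = begin
          sum (λ u → E (combine i k) u * B u v)
            ≈⟨ sum-combine n₁ (λ u → E (combine i k) u * B u v) ⟩
          sum (λ j → sum (λ l → E (combine i k) (combine {n₁} j l) * B (combine j l) v))
            ≈⟨ sum-cong-≋ (λ j → sum-cong-≋ (λ l → trans
                 (*-cong (E-combine i k j l) (B≈ j l))
                 (trans (*-congʳ (*-congʳ (sym (-1*x≈-x (Iᴹ i j)))))
                   (S.solve 5 (λ m d w g h → (m S.:* d S.:* w S.:* (g S.:* h)) S.:=
                                            (d S.:* (m S.:* g) S.:* (w S.:* h)))
                     refl (- 1#) (Iᴹ i j) (columnSum l) (g j) (h l))))) ⟩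
          sum (λ j → sum (λ l → Iᴹ i j * (- 1# * g j) * (columnSum l * h l)))
            ≈⟨ sum-cong-≋ (λ j → *-distribˡ-sum (Iᴹ i j * (- 1# * g j)) (λ l → columnSum l * h l)) ⟨
          sum (λ j → Iᴹ i j * (- 1# * g j) * W)
            ≈⟨ *-distribʳ-sum W (λ j → Iᴹ i j * (- 1# * g j)) ⟨
          sum (λ j → Iᴹ i j * (- 1# * g j)) * W
            ≈⟨ *-congʳ (trans (*ᴹ-identityˡ {n = 1} (λ j _ → - 1# * g j) i zero) (-1*x≈-x (g i))) ⟩
          - g i * W ∎
          where
          W = sum (λ l → columnSum l * h l)

        topRight≈ : topRight p M ≈ᴹ E *ᴹ bottomRight p M
        topRight≈ = combine-induction n₁ λ i k → combine-induction n₁ λ j l → begin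
          M (a i k) (b j l)
            ≈⟨ M-ab i k j l ⟩
          - Iᴹ i j
            ≈⟨ trans (*-congˡ (columnSum-D l)) (*-identityʳ _) ⟨
          - Iᴹ i j * sum (λ l′ → columnSum l′ * D l′ l)
            ≈⟨ E*-combine (bottomRight p M) (λ i → Iᴹ i j) (λ l′ → D l′ l) i k (combine j l)
                 (λ i k → M-bb i k j l) ⟨
          (E *ᴹ bottomRight p M) (combine i k) (combine j l) ∎

        E*bottomLeft : ∀ i k j l → (E *ᴹ bottomLeft p M) (combine i k) (combine j l) ≈ Iᴹ i j * χ
        E*bottomLeft i k j l = begin
          (E *ᴹ bottomLeft p M) (combine i k) (combine j l)
            ≈⟨ E*-combine (bottomLeft p M) (λ i → - Iᴹ i j) (λ _ → 1#) i k (combine j l)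
                 (λ i k → trans (M-ba i k j l) (sym (*-identityʳ _))) ⟩
          - - Iᴹ i j * sum (λ l → columnSum l * 1#)
            ≈⟨ *-cong (-‿involutive _) (sum-cong-≋ (λ l → *-identityʳ (columnSum l))) ⟩
          Iᴹ i j * χ ∎

        -- The summand r₁ n₂ of α joins n₂ A₁, and r₁ + A₁ = Q(G₁) by regularity.
        quotientMatrix : ∀ i j →
          α * Iᴹ i j - N₂ * (A₁ i j + Iᴹ i j * χ) ≈
          ((t - N₂ - N₂ * χ) ·I- (λ i j → N₂ * signlessLaplacian G₁ i j)) i j
        quotientMatrix i j = begin
          α * δ - N₂ * (A₁ i j + δ * χ)
            ≈⟨ +-congˡ (-‿cong (S.solve 4 (λ n a d x → (n S.:* (a S.:+ d S.:* x)) S.:=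
                                                      (n S.:* x S.:* d S.:+ n S.:* a))
                                  refl N₂ (A₁ i j) δ χ)) ⟩
          α * δ - (N₂ * χ * δ + N₂ * A₁ i j)
            ≈⟨ merge α (N₂ * χ) δ (N₂ * A₁ i j) ⟩
          (t - fromℕ r₁ * N₂ - N₂ - N₂ * χ) * δ - N₂ * A₁ i j
            ≈⟨ +-congʳ (*-congʳ (S.solve 4 (λ t x y z → (t S.:+ x S.:+ y S.:+ z) S.:=
                                                        (t S.:+ y S.:+ z S.:+ x))
                                  refl t (- (fromℕ r₁ * N₂)) (- N₂) (- (N₂ * χ)))) ⟩
          (t - N₂ - N₂ * χ - fromℕ r₁ * N₂) * δ - N₂ * A₁ i j
            ≈⟨ merge (t - N₂ - N₂ * χ) (fromℕ r₁ * N₂) δ (N₂ * A₁ i j) ⟨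
          (t - N₂ - N₂ * χ) * δ - (fromℕ r₁ * N₂ * δ + N₂ * A₁ i j)
            ≈⟨ +-congˡ (-‿cong (S.solve 4 (λ r n d a → (r S.:* n S.:* d S.:+ n S.:* a) S.:=
                                                       (n S.:* (r S.:* d S.:+ a)))
                                  refl (fromℕ r₁) N₂ δ (A₁ i j))) ⟩
          (t - N₂ - N₂ * χ) * δ - N₂ * (fromℕ r₁ * δ + A₁ i j)
            ≈⟨ +-congˡ (-‿cong (*-congˡ (signlessLaplacian-regular G₁ regular₁ i j))) ⟨
          (t - N₂ - N₂ * χ) * δ - N₂ * signlessLaplacian G₁ i j ∎
          where
          δ = Iᴹ i j

        schurComplement : ∀ i k j l →
          topLeft p M (combine i k) (combine j l) - (E *ᴹ bottomLeft p M) (combine i k) (combine j l) ≈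
          α * Iᴹ (combine i k) (combine j l) - (A₁ i j + Iᴹ i j * χ)
        schurComplement i k j l = trans
          (+-cong (M-aa i k j l) (-‿cong (E*bottomLeft i k j l)))
          (sym (x-[y+z]≈x-y-z _ _ _))

  det-signlessLaplacian-⊛ :
    ∀ {n₁ n₂ r₁ r₂} .{{_ : NonZero n₂}} (G₁ : Graph n₁) (G₂ : Graph n₂) →
    Regular r₁ G₁ → Regular r₂ G₂ →
    ∀ t {e} → e * (t - fromℕ r₁ * fromℕ n₂ - fromℕ n₂) ≈ 1# →
    (N : Matrix n₂ n₂) → N *ᴹ ((t - fromℕ n₂) ·I- signlessLaplacian G₂) ≈ᴹ Iᴹ →
    det (t ·I- signlessLaplacian (G₁ ⊛ G₂)) ≈
      (t - fromℕ r₁ * fromℕ n₂ - fromℕ n₂) ^ (n₁ ℕ.* (n₂ ℕ.∸ 1)) *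
      det ((t - fromℕ n₂) ·I- signlessLaplacian G₂) ^ n₁ *
      det ((t - fromℕ n₂ - fromℕ n₂ * sum (λ l → sum (λ k → N k l))) ·I-
           (λ i j → fromℕ n₂ * signlessLaplacian G₁ i j))
  -- Exposing the successor identifies n₂ ∸ 1 with the exponent that `det-c-⊗J` produces.
  det-signlessLaplacian-⊛ {n₁} {n₂@(suc n₂-1)} G₁ G₂ regular₁ regular₂ t eα≈1 N ND≈I = begin
    det (M t)
      ≈⟨ det-schur (M t) E⁻ (topRight≈ t N ND≈I) ⟩
    det (λ u v → topLeft p (M t) u v - (E⁻ *ᴹ bottomLeft p (M t)) u v) * det (bottomRight p (M t))
      ≈⟨ *-cong (det-c-⊗J n₁ n₂-1 eα≈1 _ _ (schurComplement t N ND≈I)) (det-I⊗ n₁ (D t) _ (M-bb t)) ⟩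
    α t ^ (n₁ ℕ.* n₂-1) * det (α t ·I- (λ i j → N₂ * (A₁ i j + Iᴹ i j * χ t N ND≈I))) * det (D t) ^ n₁
      ≈⟨ *-congʳ (*-congˡ (det-cong {n₁} (quotientMatrix t N ND≈I))) ⟩
    α t ^ (n₁ ℕ.* n₂-1) * det last * det (D t) ^ n₁
      ≈⟨ S.solve 3 (λ x y z → (x S.:* y S.:* z) S.:= (x S.:* z S.:* y)) refl
           (α t ^ (n₁ ℕ.* n₂-1)) (det last) (det (D t) ^ n₁) ⟩
    α t ^ (n₁ ℕ.* n₂-1) * det (D t) ^ n₁ * det last ∎
    where
    open Product G₁ G₂ regular₁ regular₂
    E⁻ = E t N ND≈I
    last = (t - N₂ - N₂ * χ t N ND≈I) ·I- (λ i j → N₂ * signlessLaplacian G₁ i j)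

-- Ring homomorphisms and evaluation of polynomials

module _ (R : CommutativeRing c ℓ) (S : CommutativeRing c′ ℓ′) where
  private
    module R = CommutativeRing R
    module S = CommutativeRing S
  open RingProperties S.ring using (+-identityˡ-unique; +-inverseˡ-unique)

  -- Additivity into a group already forces zero and negatives to be preserved: the image of zero is
  -- idempotent under addition.
  isRingHomomorphism : (⟦_⟧ : R.Carrier → S.Carrier) →
    (∀ {x y} → x R.≈ y → ⟦ x ⟧ S.≈ ⟦ y ⟧) →
    (∀ x y → ⟦ x R.+ y ⟧ S.≈ ⟦ x ⟧ S.+ ⟦ y ⟧) →
    (∀ x y → ⟦ x R.* y ⟧ S.≈ ⟦ x ⟧ S.* ⟦ y ⟧) →
    ⟦ R.1# ⟧ S.≈ S.1# → IsRingHomomorphism R.rawRing S.rawRing ⟦_⟧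
  isRingHomomorphism ⟦_⟧ ⟦⟧-cong +-homo *-homo 1#-homo = record
    { isSemiringHomomorphism = record
      { isNearSemiringHomomorphism = record
        { +-isMonoidHomomorphism = record
          { isMagmaHomomorphism = record
            { isRelHomomorphism = record { cong = ⟦⟧-cong }
            ; homo = +-homo
            }
          ; ε-homo = 0#-homo
          }
        ; *-homo = *-homo
        }
      ; 1#-homo = 1#-homo
      }
    ; -‿homo = λ x → +-inverseˡ-unique ⟦ R.- x ⟧ ⟦ x ⟧
        (S.trans (S.sym (+-homo (R.- x) x)) (S.trans (⟦⟧-cong (R.-‿inverseˡ x)) 0#-homo))
    }
    where
    0#-homo : ⟦ R.0# ⟧ S.≈ S.0#
    0#-homo = +-identityˡ-unique ⟦ R.0# ⟧ ⟦ R.0# ⟧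
      (S.trans (S.sym (+-homo R.0# R.0#)) (⟦⟧-cong (R.+-identityˡ R.0#)))

module Homomorphisms
  (R : CommutativeRing c ℓ) (S : CommutativeRing c′ ℓ′)
  {⟦_⟧ : CommutativeRing.Carrier R → CommutativeRing.Carrier S}
  (homomorphism : IsRingHomomorphism (CommutativeRing.rawRing R) (CommutativeRing.rawRing S) ⟦_⟧)
  where

  private
    module R where
      open CommutativeRing R hiding (zero) public
      open Matrices R public
      open SemiringSum semiring public using (sum)
      open Exponentiation semiring public using (_^_)
      open CommutativeMonoidSum *-commutativeMonoid public using () renaming (sum to ∏)
    module S where
      open CommutativeRing S hiding (zero) public
      open Matrices S public
      open SemiringSum semiring public using (sum; sum-cong-≋)
      open Exponentiation semiring public using (_^_)
      open CommutativeMonoidSum *-commutativeMonoid public using () renaming (sum to ∏)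
  open IsRingHomomorphism homomorphism

  sum-homo : (f : Fin n → R.Carrier) → ⟦ R.sum f ⟧ S.≈ S.sum (⟦_⟧ ∘ f)
  sum-homo {zero}  f = 0#-homo
  sum-homo {suc n} f = S.trans (+-homo _ _) (S.+-congˡ (sum-homo (f ∘ suc)))

  ∏-homo : (f : Fin n → R.Carrier) → ⟦ R.∏ f ⟧ S.≈ S.∏ (⟦_⟧ ∘ f)
  ∏-homo {zero}  f = 1#-homo
  ∏-homo {suc n} f = S.trans (*-homo _ _) (S.*-congˡ (∏-homo (f ∘ suc)))

  ^-homo : ∀ x n → ⟦ x R.^ n ⟧ S.≈ ⟦ x ⟧ S.^ n
  ^-homo x zero    = 1#-homo
  ^-homo x (suc n) = S.trans (*-homo _ _) (S.*-congˡ (^-homo x n))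

  fromℕ-homo : ∀ n → ⟦ R.fromℕ n ⟧ S.≈ S.fromℕ n
  fromℕ-homo zero    = 0#-homo
  fromℕ-homo (suc n) = S.trans (+-homo _ _) (S.+-cong 1#-homo (fromℕ-homo n))

  sub-homo : ∀ x y → ⟦ x R.- y ⟧ S.≈ ⟦ x ⟧ S.- ⟦ y ⟧
  sub-homo x y = S.trans (+-homo x (R.- y)) (S.+-congˡ (-‿homo y))

  det-homo : (A : R.Matrix n n) → ⟦ R.det A ⟧ S.≈ S.det (λ i j → ⟦ A i j ⟧)
  det-homo {zero}  A = 1#-homo
  det-homo {suc n} A = S.trans (sum-homo term) (S.sum-cong-≋ {suc n} (λ j →
    S.trans (*-homo _ _) (S.*-cong
      (S.trans (*-homo _ (A zero j)) (S.*-congʳ (S.trans (^-homo (R.- R.1#) (toℕ j)) (sign (toℕ j)))))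
      (det-homo (λ i k → A (suc i) (punchIn j k))))))
    where
    term : Fin (suc n) → R.Carrier
    term j = (R.- R.1#) R.^ toℕ j R.* A zero j R.* R.det (λ i k → A (suc i) (punchIn j k))

    sign : ∀ k → ⟦ R.- R.1# ⟧ S.^ k S.≈ (S.- S.1#) S.^ k
    sign k = Exponentiation.^-congˡ S.semiring k (S.trans (-‿homo R.1#) (S.-‿cong 1#-homo))

  if-homo : ∀ b {x y} → ⟦ if b then x else y ⟧ S.≈ (if b then ⟦ x ⟧ else ⟦ y ⟧)
  if-homo true  = S.refl
  if-homo false = S.refl

  if-cong : ∀ b {x x′ y y′} → x S.≈ x′ → y S.≈ y′ →
            (if b then x else y) S.≈ (if b then x′ else y′)
  if-cong true  x≈x′ y≈y′ = x≈x′
  if-cong false x≈x′ y≈y′ = y≈y′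

  diagonal-homo : (d : Fin n → R.Carrier) {e : Fin n → S.Carrier} → (∀ i → ⟦ d i ⟧ S.≈ e i) →
                  ∀ i j → ⟦ R.diagonal d i j ⟧ S.≈ S.diagonal e i j
  diagonal-homo d d≈e i j = S.trans (if-homo (does (i ≟ j))) (if-cong (does (i ≟ j)) (d≈e i) 0#-homo)

  ·I--homo : ∀ t (A : R.Matrix n n) i j →
             ⟦ (t R.·I- A) i j ⟧ S.≈ (⟦ t ⟧ S.·I- (λ i j → ⟦ A i j ⟧)) i j
  ·I--homo t A i j = S.trans (sub-homo _ _)
    (S.+-congʳ (S.trans (*-homo _ _) (S.*-congˡ (diagonal-homo (λ _ → R.1#) (λ _ → 1#-homo) i j))))

  signlessLaplacian-homo : (G : Graph n) → ∀ i j →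
    ⟦ R.signlessLaplacian G i j ⟧ S.≈ S.signlessLaplacian G i j
  signlessLaplacian-homo G i j = S.trans (+-homo _ _) (S.+-cong
    (diagonal-homo (λ i → R.fromℕ (degree G i)) (λ i → fromℕ-homo (degree G i)) i j)
    (S.trans (if-homo (adjacent G i j)) (if-cong (adjacent G i j) 1#-homo 0#-homo)))

module Evaluation
  (R : CommutativeRing c ℓ) (S : CommutativeRing c′ ℓ′)
  {⟦_⟧ : CommutativeRing.Carrier R → CommutativeRing.Carrier S}
  (homomorphism : IsRingHomomorphism (CommutativeRing.rawRing R) (CommutativeRing.rawRing S) ⟦_⟧)
  (z : CommutativeRing.Carrier S)
  where

  private
    module R = CommutativeRing R
    module Solver = SemiringSolver (CommutativeRing.commutativeSemiring S)
  open CommutativeRing S hiding (zero)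
  open Polynomials R
  open IsRingHomomorphism homomorphism
  open SetoidReasoning setoid
  open Solver using (_:=_; _:+_; _:*_)

  -- Horner's scheme. The point lies in `S` and the coefficients are carried there by the
  -- homomorphism, since constants of the field are to meet a rational function.
  eval : Polynomial → Carrier
  eval []      = 0#
  eval (a ∷ p) = ⟦ a ⟧ + z * eval p

  -- Equality of polynomials ignores trailing zeros, so `eval-cong` has to compare a list with a
  -- shorter one and needs the surplus to vanish.
  eval-zero : ∀ p → (∀ i → coeff p i R.≈ R.0#) → eval p ≈ 0#
  eval-zero []      p≈0 = refl
  eval-zero (a ∷ p) p≈0 = begin
    ⟦ a ⟧ + z * eval p  ≈⟨ +-cong (trans (⟦⟧-cong (p≈0 0)) 0#-homo) (*-congˡ (eval-zero p (p≈0 ∘ suc))) ⟩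
    0# + z * 0#         ≈⟨ trans (+-identityˡ _) (zeroʳ z) ⟩
    0#                  ∎

  eval-cong : ∀ {p q} → p ≈ₚ q → eval p ≈ eval q
  eval-cong {[]}    {q}     p≈q = sym (eval-zero q (λ i → R.sym (coeff-≈ p≈q i)))
  eval-cong {a ∷ p} {[]}    p≈q = eval-zero (a ∷ p) (coeff-≈ p≈q)
  eval-cong {a ∷ p} {b ∷ q} p≈q = +-cong (⟦⟧-cong (coeff-≈ p≈q 0))
    (*-congˡ (eval-cong {p} {q} (coeffwise (λ i → coeff-≈ p≈q (suc i)))))

  eval-+ : ∀ p q → eval (p +ₚ q) ≈ eval p + eval q
  eval-+ []      q       = sym (+-identityˡ _)
  eval-+ (a ∷ p) []      = sym (+-identityʳ _)
  eval-+ (a ∷ p) (b ∷ q) = begin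
    ⟦ a R.+ b ⟧ + z * eval (p +ₚ q)
      ≈⟨ +-cong (+-homo a b) (*-congˡ (eval-+ p q)) ⟩
    ⟦ a ⟧ + ⟦ b ⟧ + z * (eval p + eval q)
      ≈⟨ Solver.solve 5 (λ a b z p q → (a :+ b :+ z :* (p :+ q)) := (a :+ z :* p :+ (b :+ z :* q)))
           refl ⟦ a ⟧ ⟦ b ⟧ z (eval p) (eval q) ⟩
    ⟦ a ⟧ + z * eval p + (⟦ b ⟧ + z * eval q) ∎

  eval-· : ∀ a p → eval (a ·ₚ p) ≈ ⟦ a ⟧ * eval p
  eval-· a []      = sym (zeroʳ _)
  eval-· a (b ∷ p) = begin
    ⟦ a R.* b ⟧ + z * eval (a ·ₚ p)
      ≈⟨ +-cong (*-homo a b) (*-congˡ (eval-· a p)) ⟩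
    ⟦ a ⟧ * ⟦ b ⟧ + z * (⟦ a ⟧ * eval p)
      ≈⟨ Solver.solve 4 (λ a b z p → (a :* b :+ z :* (a :* p)) := (a :* (b :+ z :* p)))
           refl ⟦ a ⟧ ⟦ b ⟧ z (eval p) ⟩
    ⟦ a ⟧ * (⟦ b ⟧ + z * eval p) ∎

  eval-* : ∀ p q → eval (p *ₚ q) ≈ eval p * eval q
  eval-* []      q = sym (zeroˡ _)
  eval-* (a ∷ p) q = begin
    eval (a ·ₚ q +ₚ (R.0# ∷ p *ₚ q))
      ≈⟨ eval-+ (a ·ₚ q) (R.0# ∷ p *ₚ q) ⟩
    eval (a ·ₚ q) + (⟦ R.0# ⟧ + z * eval (p *ₚ q))
      ≈⟨ +-cong (eval-· a q) (trans (+-congʳ 0#-homo) (trans (+-identityˡ _) (*-congˡ (eval-* p q)))) ⟩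
    ⟦ a ⟧ * eval q + z * (eval p * eval q)
      ≈⟨ Solver.solve 4 (λ a q z p → (a :* q :+ z :* (p :* q)) := ((a :+ z :* p) :* q))
           refl ⟦ a ⟧ (eval q) z (eval p) ⟩
    (⟦ a ⟧ + z * eval p) * eval q ∎

  eval-constant : ∀ a → eval (constant a) ≈ ⟦ a ⟧
  eval-constant a = trans (+-congˡ (zeroʳ z)) (+-identityʳ _)

  eval-X : eval X ≈ z
  eval-X = begin
    ⟦ R.0# ⟧ + z * eval 1ₚ  ≈⟨ +-cong 0#-homo (*-congˡ (trans (eval-constant R.1#) 1#-homo)) ⟩
    0# + z * 1#             ≈⟨ trans (+-identityˡ _) (*-identityʳ z) ⟩
    z                       ∎

  eval-isRingHomomorphism :
    IsRingHomomorphism (CommutativeRing.rawRing polynomialRing) (CommutativeRing.rawRing S) eval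
  eval-isRingHomomorphism = isRingHomomorphism polynomialRing S eval eval-cong eval-+ eval-*
    (trans (eval-constant R.1#) 1#-homo)

module _ (R : CommutativeRing c ℓ) where
  private module R = CommutativeRing R
  open Polynomials R

  constant-isRingHomomorphism :
    IsRingHomomorphism R.rawRing (CommutativeRing.rawRing polynomialRing) constant
  constant-isRingHomomorphism = isRingHomomorphism R polynomialRing constant
    (λ a≈b → coeffwise λ where zero → a≈b ; (suc i) → R.refl)
    (λ a b → coeffwise λ _ → R.refl)
    (λ a b → coeffwise λ where zero → R.sym (R.+-identityʳ _) ; (suc i) → R.refl)
    (coeffwise λ _ → R.refl)

-- Substitution into a factored characteristic polynomial

-- A factorisation of a characteristic polynomial at the image of the variable
-- under an embedding ψ is an identity of polynomials, so it holds everywhere.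
module CharacteristicPolynomials
  (R : CommutativeRing c ℓ) (F : CommutativeRing c′ ℓ′)
  {ψ : Polynomials.Polynomial R → CommutativeRing.Carrier F}
  (monomorphism : IsRingMonomorphism (CommutativeRing.rawRing (Polynomials.polynomialRing R))
                                     (CommutativeRing.rawRing F) ψ)
  where

  private module R = CommutativeRing R
  open CommutativeRing F hiding (zero)
  open Polynomials R using (Polynomial; polynomialRing; constant; X)
  open Matrices F
  open Determinants F using (det-cong; det-*)
  open CommutativeMonoidSum *-commutativeMonoid using () renaming (sum to ∏; sum-cong-≋ to ∏-cong)
  open Exponentiation semiring using (_^_)
  open RingProperties ring using (x[y-z]≈xy-xz)
  open IsRingMonomorphism monomorphism using (injective) renaming (isRingHomomorphism to ψ-homomorphism)
  open SetoidReasoning setoid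
  private
    module R[X] where
      open CommutativeRing polynomialRing public using (_-_)
      open Matrices polynomialRing public using (Matrix; det; _·I-_)
      open CommutativeMonoidSum (CommutativeRing.*-commutativeMonoid polynomialRing) public
        using () renaming (sum to ∏)
    module Solver = SemiringSolver commutativeSemiring

  φ : R.Carrier → Carrier
  φ = ψ ∘ constant

  φ-isRingHomomorphism : IsRingHomomorphism R.rawRing rawRing φ
  φ-isRingHomomorphism =
    Composition.isRingHomomorphism trans (constant-isRingHomomorphism R) ψ-homomorphism

  module _ (A : Fin n → Fin n → R.Carrier) (ν : Fin n → R.Carrier)
           (factored : det (ψ X ·I- (λ i j → φ (A i j))) ≈ ∏ (λ i → ψ X - φ (ν i)))
           where

    private
      charPoly : R[X].Matrix n n
      charPoly = X R[X].·I- (λ i j → constant (A i j))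

      factor : Fin n → Polynomial
      factor i = X R[X].- constant (ν i)

      factoredₚ : CommutativeRing._≈_ polynomialRing (R[X].det charPoly) (R[X].∏ factor)
      factoredₚ = injective (begin
        ψ (R[X].det charPoly)
          ≈⟨ Ψ.det-homo charPoly ⟩
        det (λ i j → ψ (charPoly i j))
          ≈⟨ det-cong {n} (Ψ.·I--homo X (λ i j → constant (A i j))) ⟩
        det (ψ X ·I- (λ i j → φ (A i j)))
          ≈⟨ factored ⟩
        ∏ (λ i → ψ X - φ (ν i))
          ≈⟨ ∏-cong (λ i → Ψ.sub-homo X (constant (ν i))) ⟨
        ∏ (λ i → ψ (factor i))
          ≈⟨ Ψ.∏-homo factor ⟨
        ψ (R[X].∏ factor) ∎)
        where module Ψ = Homomorphisms polynomialRing F ψ-homomorphism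

    det-·I-factored : ∀ z → det (z ·I- (λ i j → φ (A i j))) ≈ ∏ (λ i → z - φ (ν i))
    det-·I-factored z = begin
      det (z ·I- (λ i j → φ (A i j)))
        ≈⟨ det-cong {n} (λ i j → trans (H.·I--homo X (λ i j → constant (A i j)) i j)
             (+-cong (*-congʳ eval-X) (-‿cong (eval-constant (A i j))))) ⟨
      det (λ i j → eval (charPoly i j))
        ≈⟨ H.det-homo charPoly ⟨
      eval (R[X].det charPoly)
        ≈⟨ eval-cong factoredₚ ⟩
      eval (R[X].∏ factor)
        ≈⟨ H.∏-homo factor ⟩
      ∏ (λ i → eval (factor i))
        ≈⟨ ∏-cong (λ i → trans (H.sub-homo X (constant (ν i)))
             (+-cong eval-X (-‿cong (eval-constant (ν i))))) ⟩
      ∏ (λ i → z - φ (ν i)) ∎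
      where
      -- This homomorphism agrees with ψ on constants but sends `X` to z, so it carries the
      -- polynomial identity to the new point.
      open Evaluation R F φ-isRingHomomorphism z
      module H = Homomorphisms polynomialRing F eval-isRingHomomorphism

    -- As y - s A = s (y / s - A), a factor `s ^ n` leaves the determinant and is dealt out again to
    -- the n linear factors; `u` is 1 / s.
    det-·I-scaled-factored : ∀ {s u} → u * s ≈ 1# → ∀ y →
      det (y ·I- (λ i j → s * φ (A i j))) ≈ ∏ (λ i → y - s * φ (ν i))
    det-·I-scaled-factored {s} {u} us≈1 y = begin
      det (y ·I- (λ i j → s * φ (A i j)))
        ≈⟨ det-cong {n} (λ i j → trans (x[y-z]≈xy-xz s _ _)
             (+-congʳ (trans (sym (*-assoc _ _ _)) (*-congʳ suy≈y)))) ⟨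
      det (λ i j → s * ((u * y) ·I- (λ i j → φ (A i j))) i j)
        ≈⟨ det-* {n} s _ ⟩
      s ^ n * det ((u * y) ·I- (λ i j → φ (A i j)))
        ≈⟨ *-congˡ (det-·I-factored (u * y)) ⟩
      s ^ n * ∏ (λ i → u * y - φ (ν i))
        ≈⟨ ^*∏ n (λ i → u * y - φ (ν i)) ⟩
      ∏ (λ i → s * (u * y - φ (ν i)))
        ≈⟨ ∏-cong (λ i → trans (x[y-z]≈xy-xz s (u * y) (φ (ν i))) (+-congʳ suy≈y)) ⟩
      ∏ (λ i → y - s * φ (ν i)) ∎
      where
      suy≈y : s * (u * y) ≈ y
      suy≈y = trans (sym (*-assoc _ _ _))
        (trans (*-congʳ (trans (*-comm s u) us≈1)) (*-identityˡ y))

      ^*∏ : ∀ n (g : Fin n → Carrier) → s ^ n * ∏ g ≈ ∏ (λ i → s * g i)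
      ^*∏ zero    g = *-identityˡ 1#
      ^*∏ (suc n) g = trans
        (Solver.solve 4 (λ s p x y → (s Solver.:* p Solver.:* (x Solver.:* y)) Solver.:=
                                     (s Solver.:* x Solver.:* (p Solver.:* y)))
           refl s (s ^ n) (g zero) (∏ (g ∘ suc)))
        (*-congˡ (^*∏ n (g ∘ suc)))

-- The formula for an embedded polynomial ring

module Factorisation
  (R : CommutativeRing c ℓ) (F : CommutativeRing c′ ℓ′)
  {ψ : Polynomials.Polynomial R → CommutativeRing.Carrier F}
  (monomorphism : IsRingMonomorphism (CommutativeRing.rawRing (Polynomials.polynomialRing R))
                                     (CommutativeRing.rawRing F) ψ)
  where

  private
    module R = CommutativeRing R
    module Mᴿ = Matrices R
  open CommutativeRing F hiding (zero)
  open Polynomials R using (X)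
  open Matrices F hiding (fromℕ)
  open Determinants F using (det-cong)
  open SignlessLaplacians F
  open SemiringSum semiring using (sum; sum-cong-≋)
  open CommutativeMonoidSum *-commutativeMonoid using () renaming (sum to ∏; sum-cong-≋ to ∏-cong)
  open Exponentiation semiring using (_^_; ^-congˡ)
  open CharacteristicPolynomials R F monomorphism
  open Homomorphisms R F φ-isRingHomomorphism
  open IsRingHomomorphism φ-isRingHomomorphism using (⟦⟧-cong; *-homo; 1#-homo)
  open SetoidReasoning setoid
  private
    module S = SemiringSolver commutativeSemiring

    x : Carrier
    x = ψ X

    N : ℕ → Carrier
    N n = φ (Mᴿ.fromℕ n)

    Q : Graph n → Matrix n n
    Q G i j = φ (Mᴿ.signlessLaplacian G i j)

    𝟏 : Matrix n 1
    𝟏 _ _ = 1#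

    coronal-sum : (P : Matrix n n) → sum (λ l → sum (λ k → P k l)) ≈ (transpose 𝟏 *ᴹ P *ᴹ 𝟏) zero zero
    coronal-sum P = sum-cong-≋ (λ l → sym (trans (*-identityʳ _) (sum-cong-≋ (λ k → *-identityˡ (P k l)))))

  -- Integers and Laplacians occur in two guises, formed in `F` or formed in `R` and mapped by φ;
  -- the homomorphism laws translate between them. The family `inverse` ranges over all sizes
  -- because it is applied to Q(G₂) and to a 1 × 1 matrix.
  charPoly-⊛ :
    ∀ {n₁ n₂ r₁ r₂} .{{_ : NonZero n₂}} (G₁ : Graph n₁) (G₂ : Graph n₂) →
    Regular r₁ G₁ → Regular r₂ G₂ →
    (ν : Fin n₁ → CommutativeRing.Carrier R) →
    det (x ·I- Q G₁) ≈ ∏ (λ i → x - φ (ν i)) →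
    ∀ {u} → u R.* Mᴿ.fromℕ n₂ R.≈ R.1# →
    (inverse : ∀ {m} (A : Mᴿ.Matrix m m) → Inverse ((x - N n₂) ·I- (λ i j → φ (A i j)))) →
    det (x ·I- Q (G₁ ⊛ G₂)) ≈
      (x - N r₁ * N n₂ - N n₂) ^ (n₁ ℕ.* (n₂ ℕ.∸ 1)) * det ((x - N n₂) ·I- Q G₂) ^ n₁ *
      ∏ (λ i → x - N n₂ - N n₂ * φ (ν i) -
               N n₂ * (transpose 𝟏 *ᴹ Inverse.matrix (inverse (Mᴿ.signlessLaplacian G₂)) *ᴹ 𝟏) zero zero)
  charPoly-⊛ {n₁} {n₂} {r₁} G₁ G₂ regular₁ regular₂ ν factored {u} uN≈1 inverse = begin
    det (x ·I- Q (G₁ ⊛ G₂))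
      ≈⟨ det-cong {n₁ ℕ.* n₂ ℕ.+ n₁ ℕ.* n₂} (·I-cong refl (G₁ ⊛ G₂)) ⟩
    det (x ·I- signlessLaplacian (G₁ ⊛ G₂))
      ≈⟨ det-signlessLaplacian-⊛ G₁ G₂ regular₁ regular₂ x (trans (*-congˡ (sym α≈)) eα≈1) P
           (λ i j → trans (*ᴹ-congˡ P (λ i j → sym (·I-cong x-N≈ G₂ i j)) i j) (PD≈I i j)) ⟩
    (x - F.fromℕ r₁ * F.fromℕ n₂ - F.fromℕ n₂) ^ d *
      det ((x - F.fromℕ n₂) ·I- signlessLaplacian G₂) ^ n₁ *
      det ((x - F.fromℕ n₂ - F.fromℕ n₂ * sum (λ l → sum (λ k → P k l))) ·I-
           (λ i j → F.fromℕ n₂ * signlessLaplacian G₁ i j))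
      ≈⟨ *-cong (*-cong (^-congˡ d (sym α≈))
                        (^-congˡ n₁ (det-cong {n₂} (λ i j → sym (·I-cong x-N≈ G₂ i j)))))
           (det-cong {n₁} (λ i j → +-cong
             (*-congʳ (+-cong (sym x-N≈) (-‿cong (*-cong (sym (fromℕ-homo n₂)) (coronal-sum P)))))
             (-‿cong (*-cong (sym (fromℕ-homo n₂)) (sym (signlessLaplacian-homo G₁ i j)))))) ⟩
    α ^ d * det ((x - N n₂) ·I- Q G₂) ^ n₁ * det ((x - N n₂ - N n₂ * χ) ·I- (λ i j → N n₂ * Q G₁ i j))
      ≈⟨ *-congˡ (det-·I-scaled-factored (Mᴿ.signlessLaplacian G₁) ν factored φuN≈1 (x - N n₂ - N n₂ * χ)) ⟩
    α ^ d * det ((x - N n₂) ·I- Q G₂) ^ n₁ * ∏ (λ i → x - N n₂ - N n₂ * χ - N n₂ * φ (ν i))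
      ≈⟨ *-congˡ (∏-cong (λ i → S.solve 3 (λ x y z → (x S.:+ y S.:+ z) S.:= (x S.:+ z S.:+ y)) refl
           (x - N n₂) (- (N n₂ * χ)) (- (N n₂ * φ (ν i))))) ⟩
    α ^ d * det ((x - N n₂) ·I- Q G₂) ^ n₁ * ∏ (λ i → x - N n₂ - N n₂ * φ (ν i) - N n₂ * χ) ∎
    where
    module F = Matrices F
    d = n₁ ℕ.* (n₂ ℕ.∸ 1)
    α = x - N r₁ * N n₂ - N n₂
    open Inverse (inverse (Mᴿ.signlessLaplacian G₂)) using () renaming (matrix to P; inverseˡ to PD≈I)
    χ = (transpose 𝟏 *ᴹ P *ᴹ 𝟏) zero zero

    φuN≈1 : φ u * N n₂ ≈ 1#
    φuN≈1 = trans (sym (*-homo u (Mᴿ.fromℕ n₂))) (trans (⟦⟧-cong uN≈1) 1#-homo)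

    -- α is inverted by viewing it as the 1 × 1 matrix (x - n₂) - (r₁ n₂).
    r₁n₂ : Mᴿ.Matrix 1 1
    r₁n₂ _ _ = Mᴿ.fromℕ r₁ R.* Mᴿ.fromℕ n₂

    e : Carrier
    e = Inverse.matrix (inverse r₁n₂) zero zero

    eα≈1 : e * α ≈ 1#
    eα≈1 = begin
      e * (x - N r₁ * N n₂ - N n₂)
        ≈⟨ *-congˡ (S.solve 3 (λ x y z → (x S.:+ y S.:+ z) S.:= ((x S.:+ z) S.:* S.con 1 S.:+ y)) refl
             x (- (N r₁ * N n₂)) (- N n₂)) ⟩
      e * ((x - N n₂) * 1# - N r₁ * N n₂)
        ≈⟨ *-congˡ (+-congˡ (-‿cong (*-homo (Mᴿ.fromℕ r₁) (Mᴿ.fromℕ n₂)))) ⟨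
      e * ((x - N n₂) * 1# - φ (r₁n₂ zero zero))
        -- A product of 1 × 1 matrices is a sum of one term, which unfolds with a final `0#`.
        ≈⟨ +-identityʳ _ ⟨
      e * ((x - N n₂) * 1# - φ (r₁n₂ zero zero)) + 0#
        ≈⟨ Inverse.inverseˡ (inverse r₁n₂) zero zero ⟩
      1# ∎

    x-N≈ : x - N n₂ ≈ x - F.fromℕ n₂
    x-N≈ = +-congˡ (-‿cong (fromℕ-homo n₂))

    α≈ : α ≈ x - F.fromℕ r₁ * F.fromℕ n₂ - F.fromℕ n₂
    α≈ = +-cong (+-congˡ (-‿cong (*-cong (fromℕ-homo r₁) (fromℕ-homo n₂)))) (-‿cong (fromℕ-homo n₂))

    ·I-cong : ∀ {m t t′} → t ≈ t′ → (G : Graph m) → (t ·I- Q G) ≈ᴹ (t′ ·I- signlessLaplacian G)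
    ·I-cong t≈t′ G i j = +-cong (*-congʳ t≈t′) (-‿cong (signlessLaplacian-homo G i j))

-- Specialisation to rational functions

module _ (K : HeytingField c ℓ ℓ′) where

  private
    Kᴿ : CommutativeRing c ℓ
    Kᴿ = HeytingCommutativeRing.commutativeRing (HeytingField.heytingCommutativeRing K)

    module K[X] = CommutativeRing (Polynomials.polynomialRing Kᴿ)

  open RationalFunctions K
  private module Sol = SemiringSolver K[X].commutativeSemiring
  open Sol using (_:=_; _:+_; _:*_; con)

  embed-isRingMonomorphism : IsRingMonomorphism K[X].rawRing rawRing embed
  embed-isRingMonomorphism = record
    { isRingHomomorphism = isRingHomomorphism (Polynomials.polynomialRing Kᴿ) fractionRing embed
        (λ p≈q → cross (K[X].*-congʳ p≈q))
        (λ p q → cross (Sol.solve 2 (λ p q →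
          (p :+ q) :* (con 1 :* con 1) := (p :* con 1 :+ q :* con 1) :* con 1) K[X].refl p q))
        (λ p q → cross (Sol.solve 2 (λ p q →
          (p :* q) :* (con 1 :* con 1) := (p :* q) :* con 1) K[X].refl p q))
        refl
    ; injective = λ (cross p*1≈q*1) →
        K[X].trans (K[X].sym (K[X].*-identityʳ _)) (K[X].trans p*1≈q*1 (K[X].*-identityʳ _))
    }

theorem2 : ∀ {c ℓ₁ ℓ₂} (K : HeytingField c ℓ₁ ℓ₂) →
    let open RationalFunctions K in
    CharacteristicZero →
    ∀ {n₁ n₂ r₁ r₂ : ℕ} .{{_ : NonZero n₂}}
    (G₁ : Graph n₁) (G₂ : Graph n₂) → Regular r₁ G₁ → Regular r₂ G₂ →
    (ν : Fin n₁ → HeytingField.Carrier K) → Eigenvalues (Q G₁) ν →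
    f (Q (G₁ ⊛ G₂)) x
    ≈ (x - fromℕ r₁ * fromℕ n₂ - fromℕ n₂) ^ (n₁ ℕ.* (n₂ ℕ.∸ 1))
    * f (Q G₂) (x - fromℕ n₂) ^ n₁
    * ∏ (λ i → x - fromℕ n₂ - fromℕ n₂ * const (ν i) - fromℕ n₂ * χ[ G₂ ]⟨x- n₂ ⟩)
theorem2 K char0 {n₁} {n₂} {r₁} G₁ G₂ regular₁ regular₂ ν eigenvalues =
  Factorisation.charPoly-⊛ Kᴿ fractionRing (embed-isRingMonomorphism K)
    G₁ G₂ regular₁ regular₂ ν eigenvalues
    -- Characteristic zero puts n₂ apart from 0. Apartness yields an inverse of the difference n₂ -
    -- 0, which is rewritten to n₂.
    (K.trans (K.*-congˡ (K.sym (K.x-0≈x _))) (proj₁ (proj₂ (K.#⇒invertible (char0 n₂)))))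
    (λ A → shiftedInverse A n₂)
  where
  module K where
    open HeytingField K public
    open HeytingProperties heytingCommutativeRing public
  Kᴿ = HeytingCommutativeRing.commutativeRing K.heytingCommutativeRing
  open RationalFunctions K
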